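{- We have $$\underline{sa}_4^s(6) = 11.$$ The minimum $\underline{sa}_4^s(6) = 11$ is attained, e.g., when $X$ is the vertex set of a two-fold pyramid over a parallelogram, and also when $X$ is the vertex set of the convex hull of a $4$-simplex and an additional vertex (a point outside the simplex) sufficiently close to the barycentre of one of the facets of the simplex.
   Context: Let $X=\{x_1,\dots,x_n\}\subset\mathbb{R}^d$ be a finite set (with $x_i\neq x_j$ for $i\ne j$) whose affine hull is $\mathbb{R}^d$, and let $P=\operatorname{conv}X$. Two distinct points $x_i,x_j\in X$ are strictly antipodal (in $X$) if there are different parallel supporting hyperplanes $H',H''$ of $P$ with $X\cap H'=\{x_i\}$ and $X\cap H''=\{x_j\}$. $sa(X)$ is the number of (unordered) strictly antipodal pairs of $X$. $X$ is in strictly convex position if $X=\operatorname{vert}P$ (the vertex set of $P$). $\mathcal{C}_d^s(n)$ is the family of all $X\subset\mathbb{R}^d$ with $|X|=n$, $\operatorname{aff}X=\mathbb{R}^d$, $X$ in strictly convex position, and $\underline{sa}_d^s(n):=\min\{sa(X)\mid X\in\mathcal{C}_d^s(n)\}$. A $k$-fold pyramid over a base polytope is a $k$-fold iterated pyramid over that base (at each step one adds an apex outside the affine hull of the previous polytope and takes the convex hull). -}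

module Defs where

open import Algebra.Bundles using (CommutativeRing)
open import Algebra.Core using (Op₁; Op₂)
open import Algebra.Structures using (IsCommutativeRing)
import Algebra.Properties.CommutativeMonoid.Sum as CommutativeMonoidSum
open import Data.Fin using (Fin)
open import Data.Nat as ℕ using (ℕ; zero; suc)
open import Data.Product using (_×_; _,_; ∃; ∃-syntax; Σ-syntax)
open import Data.Sum using (_⊎_)
open import Data.Vec.Functional using (Vector; []; _∷_; replicate)
import Data.Vec.Functional.Relation.Binary.Equality.Setoid as VectorEquality
open import Function.Definitions using (Injective)
open import Level using (0ℓ) renaming (suc to lsuc)
open import Relation.Binary.Core using (Rel)
open import Relation.Binary.Structures using (IsStrictTotalOrder)
import Relation.Binary.Construct.StrictToNonStrict as StrictToNonStrict
open import Relation.Binary.PropositionalEquality using (_≡_)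
open import Relation.Nullary using (¬_)
open import Relation.Unary using (Pred; _∈_; _∉_; _≐_; _∩_; _∪_; Universal; Satisfiable)

-- The classical real numbers, axiomatised up to isomorphism as a
-- Dedekind-complete (trichotomously) ordered field.  Equality is a setoid
-- equality, so that e.g. Cauchy sequences qualify in a classical metatheory.
record RealNumbers : Set₁ where
  infix  4 _≈_ _<_
  infixl 6 _+_
  infixl 7 _*_
  field
    Carrier            : Set
    _≈_ _<_            : Rel Carrier 0ℓ
    _+_ _*_            : Op₂ Carrier
    -_                 : Op₁ Carrier
    0# 1#              : Carrier
    isCommutativeRing  : IsCommutativeRing _≈_ _+_ _*_ -_ 0# 1#
    0≉1                : ¬ 0# ≈ 1#
    inverse            : ∀ x → ¬ x ≈ 0# → ∃[ y ] x * y ≈ 1#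
    isStrictTotalOrder : IsStrictTotalOrder _≈_ _<_
    +-monoˡ-<          : ∀ z {x y} → x < y → x + z < y + z
    *-pos              : ∀ {x y} → 0# < x → 0# < y → 0# < x * y

  open StrictToNonStrict _≈_ _<_ public using (_≤_)

  UpperBound : Pred Carrier 0ℓ → Pred Carrier 0ℓ
  UpperBound S u = ∀ x → x ∈ S → x ≤ u

  field
    complete : ∀ (S : Pred Carrier 0ℓ) → Satisfiable S → Satisfiable (UpperBound S) →
               ∃[ s ] s ∈ UpperBound S × (∀ u → u ∈ UpperBound S → s ≤ u)

  commutativeRing : CommutativeRing 0ℓ 0ℓ
  commutativeRing = record { isCommutativeRing = isCommutativeRing }

  open CommutativeRing commutativeRing public
    using (_-_; setoid; +-commutativeMonoid)

-- "S has exactly n elements, counted up to _~_"; it also forces S to be closed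
-- under _~_.
HasCardinality : {A : Set} → Rel A 0ℓ → Pred A 0ℓ → ℕ → Set
HasCardinality {A} _~_ S n =
  Σ[ e ∈ (Fin n → A) ] Injective _≡_ _~_ e × S ≐ (λ a → ∃[ i ] a ~ e i)

module Convex (ℝ : RealNumbers) where

  open RealNumbers ℝ
  open VectorEquality setoid public using (_≋_)
  open CommutativeMonoidSum +-commutativeMonoid public using (sum)

  Point : ℕ → Set
  Point d = Vector Carrier d

  Subset : ℕ → Set₁
  Subset d = Pred (Point d) 0ℓ

  private
    variable
      d m n : ℕ

  range : Vector (Point d) n → Subset d
  range y p = ∃[ i ] p ≋ y i

  ｛_｝ : Point d → Subset d
  ｛ v ｝ p = p ≋ v

  ⟨_,_⟩ : Point d → Point d → Carrier
  ⟨ p , q ⟩ = sum (λ c → p c * q c)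

  dist² : Point d → Point d → Carrier
  dist² p q = ⟨ (λ c → p c - q c) , (λ c → p c - q c) ⟩

  linComb : Vector Carrier m → Vector (Point d) m → Point d
  linComb w y c = sum (λ i → w i * y i c)

  aff : Subset d → Subset d
  aff {d} S p = ∃[ m ] Σ[ y ∈ Vector (Point d) m ] Σ[ w ∈ Vector Carrier m ]
    (∀ i → y i ∈ S) × sum w ≈ 1# × p ≋ linComb w y

  conv : Subset d → Subset d
  conv {d} S p = ∃[ m ] Σ[ y ∈ Vector (Point d) m ] Σ[ w ∈ Vector Carrier m ]
    (∀ i → y i ∈ S) × (∀ i → 0# ≤ w i) × sum w ≈ 1# × p ≋ linComb w y

  AffinelyIndependent : Vector (Point d) n → Set
  AffinelyIndependent {d} {n} y = ∀ (w : Vector Carrier n) →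
    sum w ≈ 0# → linComb w y ≋ replicate d 0# → w ≋ replicate n 0#

  record Hyperplane (d : ℕ) : Set where
    field
      normal   : Point d
      offset   : Carrier
      normal≉0 : ¬ normal ≋ replicate d 0#

  open Hyperplane public

  ⟦_⟧ : Hyperplane d → Subset d
  ⟦ H ⟧ p = ⟨ normal H , p ⟩ ≈ offset H

  Parallel : Hyperplane d → Hyperplane d → Set
  Parallel H′ H″ = ∃[ t ] normal H″ ≋ (λ c → t * normal H′ c)

  Supports : Hyperplane d → Subset d → Set
  Supports H P = Satisfiable (P ∩ ⟦ H ⟧) ×
    ( (∀ p → p ∈ P → ⟨ normal H , p ⟩ ≤ offset H)
    ⊎ (∀ p → p ∈ P → offset H ≤ ⟨ normal H , p ⟩))

  vert : Subset d → Subset d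
  vert {d} P v = Σ[ H ∈ Hyperplane d ] Supports H P × (P ∩ ⟦ H ⟧) ≐ ｛ v ｝

  StrictlyAntipodal : Subset d → Point d → Point d → Set
  StrictlyAntipodal {d} X p q =
    p ∈ X × q ∈ X × ¬ p ≋ q ×
    Σ[ H′ ∈ Hyperplane d ] Σ[ H″ ∈ Hyperplane d ]
      Supports H′ (conv X) × Supports H″ (conv X) ×
      Parallel H′ H″ × ¬ (⟦ H′ ⟧ ≐ ⟦ H″ ⟧) ×
      (X ∩ ⟦ H′ ⟧) ≐ ｛ p ｝ × (X ∩ ⟦ H″ ⟧) ≐ ｛ q ｝

  -- (p , q) and (q , p) are the same unordered pair.
  SameUnorderedPair : Rel (Point d × Point d) 0ℓ
  SameUnorderedPair (p , q) (p′ , q′) = (p ≋ p′ × q ≋ q′) ⊎ (p ≋ q′ × q ≋ p′)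

  -- Sa X k says sa(X) = k.  The number is given by its graph, because the cardinality of a
  -- set is not a function of the set constructively.
  Sa : Subset d → ℕ → Set
  Sa X k = HasCardinality SameUnorderedPair (λ (p , q) → StrictlyAntipodal X p q) k

  𝒞ˢ : (d n : ℕ) → Pred (Subset d) 0ℓ
  𝒞ˢ d n X = HasCardinality _≋_ X n × Universal (aff X) × X ≐ vert (conv X)

  Attains : (d n k : ℕ) → Subset d → Set
  Attains d n k X = X ∈ 𝒞ˢ d n × Sa X k

  -- The minimum of sa over 𝒞ˢ d n is k.  The second half also asserts that
  -- sa(X) exists, so that no X escapes the bound.
  MinSa : (d n k : ℕ) → Set₁
  MinSa d n k =
    Satisfiable (Attains d n k) ×
    (∀ X → X ∈ 𝒞ˢ d n → ∃[ m ] Sa X m × k ℕ.≤ m)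

  data IsPyramid {d : ℕ} (B : Subset d) : ℕ → Subset d → Set₁ where
    base : ∀ {P} → P ≐ B → IsPyramid B 0 P
    apex : ∀ {k P Q} (v : Point d) → IsPyramid B k Q → v ∉ aff Q →
           P ≐ conv (Q ∪ ｛ v ｝) → IsPyramid B (suc k) P

  -- The parallelogram a b c e, in cyclic order, is not allowed to be degenerate.
  IsParallelogram : Subset d → Set
  IsParallelogram {d} Q =
    Σ[ a ∈ Point d ] Σ[ b ∈ Point d ] Σ[ c ∈ Point d ] Σ[ e ∈ Point d ]
      AffinelyIndependent (a ∷ b ∷ c ∷ []) ×
      (λ i → a i + c i) ≋ (λ i → b i + e i) ×
      Q ≐ conv (range (a ∷ b ∷ c ∷ e ∷ []))

  -- n · g is the sum of the n points.
  IsBarycentre : Vector (Point d) n → Point d → Set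
  IsBarycentre {n = n} y g = ∀ c → sum (replicate n (g c)) ≈ sum (λ i → y i c)

  ForAllSufficientlyCloseTo : Point d → Subset d → Set
  ForAllSufficientlyCloseTo g Q =
    ∃[ ε ] 0# < ε × (∀ p → dist² p g < ε * ε → p ∈ Q)

{-# OPTIONS --safe #-}
module Submission where

-- Six points e spanning ℝ⁴ satisfy exactly one affine dependence up to scaling,
-- Σ aᵢ eᵢ = Σ bᵢ eᵢ with a, b ≥ 0 of disjoint support and Σ a = Σ b = T (a Gale diagram), and a
-- vector y lists the values of an affine function at e iff ⟨ a , y ⟩ = ⟨ b , y ⟩.  In these terms
-- all points are vertices iff aᵢ < T and bᵢ < T for all i, and eᵢ, eⱼ are strictly antipodal iff
-- aᵢ + bⱼ < T and aⱼ + bᵢ < T.  If T ≤ aᵢ + bⱼ and T ≤ aᵢ′ + bⱼ′ for two disjoint pairs, these use up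
-- all of Σ a + Σ b = 2T, so that every violating pair joins {i , i′} to {j , j′}; otherwise the violating
-- pairs form a star, and its centre misses a further point with a coefficient of the same sign.
-- Either way at most 4 of the 15 pairs violate.  The parallelogram gives a square of violating
-- pairs, the capped simplex a star with 4 edges.

open import Defs
open import Algebra.Bundles using (CommutativeRing; RawRing)
import Algebra.Properties.Ring as RingProperties
import Algebra.Properties.Semiring.Mult.TCOptimised as Multiples
import Algebra.Properties.Semiring.Sum as SemiringSum
import Algebra.Solver.Ring as RingSolver
open import Algebra.Solver.Ring.AlmostCommutativeRing using (fromCommutativeRing; _-Raw-AlmostCommutative⟶_)
open import Data.Fin using (Fin; zero; suc; punchIn; punchOut)
import Data.Fin as Fin
open import Data.Fin.Patterns using (0F; 1F; 2F; 3F; 4F; 5F)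
open import Data.Fin.Properties using (any?; all?; punchIn-punchOut)
import Data.Fin.Properties as Fin
open import Data.List using (List; filter; cartesianProduct; allFin; length; lookup)
open import Data.List.Membership.Propositional using () renaming (_∈_ to _∈ₗ_)
open import Data.List.Membership.Propositional.Properties using (∈-lookup; ∈-filter⁺; ∈-filter⁻; ∈-cartesianProduct⁺; ∈-allFin)
import Data.List.Relation.Unary.All as All
open import Data.List.Relation.Unary.AllPairs using () renaming (_∷_ to _∷ₚ_)
open import Data.List.Relation.Unary.Any using (index)
open import Data.List.Relation.Unary.Any.Properties using (lookup-index)
open import Data.List.Relation.Unary.Unique.Propositional using (Unique)
import Data.List.Relation.Unary.Unique.Propositional.Properties as Unique
import Data.List.Relation.Binary.Sublist.Propositional as Sublist
import Data.List.Relation.Binary.Sublist.Propositional.Properties as Sublist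
open import Data.Maybe using (Maybe; just; nothing)
open import Data.Nat as ℕ using (ℕ; zero; suc)
import Data.Nat.Properties as ℕ
open import Data.Product using (_×_; _,_; ∃-syntax; Σ-syntax; proj₁; proj₂)
open import Data.Sum using (_⊎_; inj₁; inj₂; [_,_]′)
import Data.Sum as Sum
open import Data.Vec.Functional using (Vector; []; _∷_; replicate; insertAt; removeAt; updateAt; tail)
open import Data.Vec.Functional.Properties using (insertAt-lookup; insertAt-punchIn; updateAt-updates; updateAt-minimal)
open import Function using (const; _∘_)
open import Function.Definitions using (Injective)
open import Level using (0ℓ)
open import Relation.Binary.Definitions using (Decidable; tri<; tri≈; tri>)
import Relation.Binary.Construct.StrictToNonStrict as StrictToNonStrict
open import Relation.Binary.PropositionalEquality as ≡ using (_≡_; _≢_)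
open import Relation.Binary.Structures using (IsStrictTotalOrder)
open import Relation.Nullary using (¬_; yes; no; contradiction; ¬?; _×-dec_; _⊎-dec_)
open import Relation.Nullary.Decidable using (decidable-stable; from-yes)
open import Relation.Unary using (Pred; Universal; _∈_; _∉_; _⊆_; _≐_; _∩_; _∪_) renaming (Decidable to Decidable₁)

-- The criteria hold because one linear equation leaves room for very simple functions: apart from
-- the prescribed minimum and maximum, y needs only one level on the support of a and one on the
-- support of b. Balance is then solved by explicit levels, and their positivity is exactly the
-- inequality in question. For the converse an arbitrary exposing functional has to be used, and
-- supporting hyperplanes carry no orientation; signs σ and τ with square 1 repair this. Each
-- inequality aₚ + b_q < T is treated as directed. Its failure forces aₚ > 0 and b_q > 0, so the
-- violating pairs form a bipartite graph between the two supports, and a bipartite graph without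
-- two disjoint edges is a star. The order is trichotomous, hence decidable, so searches over finite
-- index sets replace case distinctions on geometric configurations, and sa(X) is obtained as the
-- length of a filtered list. The violating pairs of a general X are never listed: they are enclosed
-- in a relation on `Fin 6` whose complement is counted by evaluation.

-- Ring solver with integer coefficients.

module IntegerSolver (R : CommutativeRing 0ℓ 0ℓ) where
  open CommutativeRing R hiding (zero)
  open Multiples semiring using (×-homo-+; ×1-homo-*) renaming (_×_ to _∙_)
  open RingProperties ring
  open import Relation.Binary.Reasoning.Setoid setoid

  private
    reduce : ℕ × ℕ → ℕ × ℕ
    reduce (zero  , n)     = zero , n
    reduce (suc m , zero)  = suc m , zero
    reduce (suc m , suc n) = reduce (m , n)

    -- The integer m - n is represented by (m , n); the solver compares coefficients of
    -- normal forms syntactically, so they have to be reduced.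
    coefficients : RawRing 0ℓ 0ℓ
    coefficients = record
      { Carrier = ℕ × ℕ
      ; _≈_     = _≡_
      ; _+_     = λ (m , n) (p , q) → reduce (m ℕ.+ p , n ℕ.+ q)
      ; _*_     = λ (m , n) (p , q) → reduce (m ℕ.* p ℕ.+ n ℕ.* q , m ℕ.* q ℕ.+ n ℕ.* p)
      ; -_      = λ (m , n) → n , m
      ; 0#      = 0 , 0
      ; 1#      = 1 , 0
      }

    value : ℕ × ℕ → Carrier
    value (m , zero)  = m ∙ 1#
    value (m , suc n) = m ∙ 1# - suc n ∙ 1#

    value≈ : ∀ x → value x ≈ proj₁ x ∙ 1# - proj₂ x ∙ 1#
    value≈ (m , zero)  = sym (trans (+-congˡ -0#≈0#) (+-identityʳ _))
    value≈ (m , suc n) = refl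

    interchange : ∀ a b c d → (a + b) + (c + d) ≈ (a + c) + (b + d)
    interchange a b c d = begin
      (a + b) + (c + d)  ≈⟨ +-assoc _ _ _ ⟩
      a + (b + (c + d))  ≈⟨ +-congˡ (trans (sym (+-assoc _ _ _)) (trans (+-congʳ (+-comm b c)) (+-assoc _ _ _))) ⟩
      a + (c + (b + d))  ≈⟨ +-assoc _ _ _ ⟨
      (a + c) + (b + d)  ∎

    +-minus : ∀ a b c d → (a + b) - (c + d) ≈ (a - c) + (b - d)
    +-minus a b c d = trans (+-congˡ (sym (-‿+-comm c d))) (interchange _ _ _ _)

    shift : ∀ a b c → a - b ≈ (a + c) - (b + c)
    shift a b c = sym (trans (+-minus a c b c) (trans (+-congˡ (-‿inverseʳ c)) (+-identityʳ _)))

    reduce≈ : ∀ x → value (reduce x) ≈ proj₁ x ∙ 1# - proj₂ x ∙ 1#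
    reduce≈ (zero  , n)     = value≈ (zero , n)
    reduce≈ (suc m , zero)  = value≈ (suc m , zero)
    reduce≈ (suc m , suc n) = begin
      value (reduce (m , n))                 ≈⟨ reduce≈ (m , n) ⟩
      m ∙ 1# - n ∙ 1#                        ≈⟨ shift _ _ 1# ⟩
      (m ∙ 1# + 1#) - (n ∙ 1# + 1#)          ≈⟨ +-cong (sucʳ m) (-‿cong (sucʳ n)) ⟩
      suc m ∙ 1# - suc n ∙ 1#                ∎
      where
      sucʳ : ∀ k → k ∙ 1# + 1# ≈ suc k ∙ 1#
      sucʳ k = trans (+-comm _ _) (sym (×-homo-+ 1# 1 k))

    *-minus : ∀ a b c d → (a * c + b * d) - (a * d + b * c) ≈ (a - b) * (c - d)
    *-minus a b c d = begin
      (a * c + b * d) - (a * d + b * c)              ≈⟨ +-minus _ _ _ _ ⟩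
      (a * c - a * d) + (b * d - b * c)              ≈⟨ +-congˡ (+-comm _ _) ⟩
      (a * c - a * d) + (- (b * c) + b * d)          ≈⟨ +-congˡ (+-cong (-‿distribˡ-* b c) b*d) ⟩
      (a * c - a * d) + (- b * c + - b * - d)        ≈⟨ +-cong (+-congˡ (-‿distribʳ-* a d)) refl ⟩
      (a * c + a * - d) + (- b * c + - b * - d)      ≈⟨ +-cong (distribˡ _ _ _) (distribˡ _ _ _) ⟨
      a * (c - d) + - b * (c - d)                    ≈⟨ distribʳ _ _ _ ⟨
      (a - b) * (c - d)                              ∎
      where
      b*d : b * d ≈ - b * - d
      b*d = begin
        b * d          ≈⟨ -‿involutive _ ⟨
        - - (b * d)    ≈⟨ -‿cong (-‿distribʳ-* b d) ⟩
        - (b * - d)    ≈⟨ -‿distribˡ-* b (- d) ⟩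
        - b * - d      ∎

    morphism : coefficients -Raw-AlmostCommutative⟶ fromCommutativeRing R
    morphism = record
      { ⟦_⟧    = value
      ; +-homo = λ x@(m , n) y@(p , q) → begin
          value (reduce (m ℕ.+ p , n ℕ.+ q))   ≈⟨ reduce≈ (m ℕ.+ p , n ℕ.+ q) ⟩
          (m ℕ.+ p) ∙ 1# - (n ℕ.+ q) ∙ 1#      ≈⟨ +-cong (×-homo-+ 1# m p) (-‿cong (×-homo-+ 1# n q)) ⟩
          (m ∙ 1# + p ∙ 1#) - (n ∙ 1# + q ∙ 1#) ≈⟨ +-minus _ _ _ _ ⟩
          (m ∙ 1# - n ∙ 1#) + (p ∙ 1# - q ∙ 1#) ≈⟨ +-cong (value≈ x) (value≈ y) ⟨
          value x + value y                     ∎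
      ; *-homo = λ x@(m , n) y@(p , q) → begin
          value (reduce (m ℕ.* p ℕ.+ n ℕ.* q , m ℕ.* q ℕ.+ n ℕ.* p))
            ≈⟨ reduce≈ (m ℕ.* p ℕ.+ n ℕ.* q , m ℕ.* q ℕ.+ n ℕ.* p) ⟩
          (m ℕ.* p ℕ.+ n ℕ.* q) ∙ 1# - (m ℕ.* q ℕ.+ n ℕ.* p) ∙ 1#
            ≈⟨ +-cong (*-homo₂ m p n q) (-‿cong (*-homo₂ m q n p)) ⟩
          (m ∙ 1# * p ∙ 1# + n ∙ 1# * q ∙ 1#) - (m ∙ 1# * q ∙ 1# + n ∙ 1# * p ∙ 1#)
            ≈⟨ *-minus _ _ _ _ ⟩
          (m ∙ 1# - n ∙ 1#) * (p ∙ 1# - q ∙ 1#)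
            ≈⟨ *-cong (value≈ x) (value≈ y) ⟨
          value x * value y                     ∎
      ; -‿homo = λ x@(m , n) → begin
          value (n , m)           ≈⟨ value≈ (n , m) ⟩
          n ∙ 1# - m ∙ 1#         ≈⟨ ⁻¹-anti-homo-// _ _ ⟨
          - (m ∙ 1# - n ∙ 1#)     ≈⟨ -‿cong (value≈ x) ⟨
          - value x               ∎
      ; 0-homo = refl
      ; 1-homo = refl
      }
      where
      *-homo₂ : ∀ m p n q → (m ℕ.* p ℕ.+ n ℕ.* q) ∙ 1# ≈ m ∙ 1# * p ∙ 1# + n ∙ 1# * q ∙ 1#
      *-homo₂ m p n q = trans (×-homo-+ 1# (m ℕ.* p) (n ℕ.* q)) (+-cong (×1-homo-* m p) (×1-homo-* n q))

    -- The integers m - n and p - q agree when m + q = p + n in ℕ; the identity transfers to any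
    -- ring.
    sameInteger : ∀ x y → Maybe (value x ≈ value y)
    sameInteger x@(m , n) y@(p , q) with (m ℕ.+ q) ℕ.≟ (p ℕ.+ n)
    ... | no _   = nothing
    ... | yes eq = just (begin
      value x                                      ≈⟨ value≈ x ⟩
      m ∙ 1# - n ∙ 1#                              ≈⟨ shift _ _ _ ⟩
      (m ∙ 1# + q ∙ 1#) - (n ∙ 1# + q ∙ 1#)        ≈⟨ +-congʳ (sym (×-homo-+ 1# m q)) ⟩
      (m ℕ.+ q) ∙ 1# - (n ∙ 1# + q ∙ 1#)           ≡⟨ ≡.cong (λ k → k ∙ 1# - (n ∙ 1# + q ∙ 1#)) eq ⟩
      (p ℕ.+ n) ∙ 1# - (n ∙ 1# + q ∙ 1#)           ≈⟨ +-cong (×-homo-+ 1# p n) (-‿cong (+-comm _ _)) ⟩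
      (p ∙ 1# + n ∙ 1#) - (q ∙ 1# + n ∙ 1#)        ≈⟨ shift _ _ _ ⟨
      p ∙ 1# - q ∙ 1#                              ≈⟨ value≈ y ⟨
      value y                                      ∎)

  open RingSolver coefficients (fromCommutativeRing R) morphism sameInteger public
    using (Polynomial; solve; _:=_; _:+_; _:*_; _:-_; :-_; con)

-- Order and cancellation in an ordered field.

module OrderedField (ℝ : RealNumbers) where

  open RealNumbers ℝ
  open CommutativeRing commutativeRing public
    using ( refl; sym; trans; reflexive; isEquivalence; semiring; ring
          ; +-cong; +-congˡ; +-congʳ; +-comm; +-assoc; +-identityˡ; +-identityʳ
          ; *-cong; *-congˡ; *-congʳ; *-comm; *-assoc; *-identityˡ; *-identityʳ
          ; distribʳ; zeroˡ; zeroʳ; -‿cong; -‿inverseʳ)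
  open IntegerSolver commutativeRing public
  open IsStrictTotalOrder isStrictTotalOrder public
    using (_≟_; _<?_; compare; <-resp-≈; <-respˡ-≈; <-respʳ-≈)
    renaming (trans to <-trans; irrefl to <-irrefl; asym to <-asym)
  open import Relation.Binary.Reasoning.Setoid setoid

  infix 4 _≤?_

  _≤?_ : Decidable _≤_
  _≤?_ = StrictToNonStrict.decidable′ _≈_ _<_ compare

  ≤-refl : ∀ {x} → x ≤ x
  ≤-refl = inj₂ refl

  ≤-trans : ∀ {x y z} → x ≤ y → y ≤ z → x ≤ z
  ≤-trans = StrictToNonStrict.trans _≈_ _<_ isEquivalence <-resp-≈ <-trans

  <-≤-trans : ∀ {x y z} → x < y → y ≤ z → x < z
  <-≤-trans = StrictToNonStrict.<-≤-trans _≈_ _<_ <-trans <-respʳ-≈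

  ≤-respʳ-≈ : ∀ {x y z} → y ≈ z → x ≤ y → x ≤ z
  ≤-respʳ-≈ = StrictToNonStrict.≤-respʳ-≈ _≈_ _<_ trans <-respʳ-≈

  ≤-respˡ-≈ : ∀ {x y z} → y ≈ z → y ≤ x → z ≤ x
  ≤-respˡ-≈ = StrictToNonStrict.≤-respˡ-≈ _≈_ _<_ sym trans <-respˡ-≈

  ≮⇒≥ : ∀ {x y} → ¬ x < y → y ≤ x
  ≮⇒≥ {x} {y} x≮y with compare x y
  ... | tri< x<y _ _ = contradiction x<y x≮y
  ... | tri≈ _ x≈y _ = inj₂ (sym x≈y)
  ... | tri> _ _ y<x = inj₁ y<x

  0<y-x⇒x<y : ∀ {x y} → 0# < y - x → x < y
  0<y-x⇒x<y {x} {y} p = <-respˡ-≈ (+-identityˡ x)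
    (<-respʳ-≈ (solve 2 (λ x y → y :- x :+ x := y) refl x y) (+-monoˡ-< x p))

  x<y⇒0<y-x : ∀ {x y} → x < y → 0# < y - x
  x<y⇒0<y-x {x} p = <-respˡ-≈ (-‿inverseʳ x) (+-monoˡ-< (- x) p)

  0≤y-x⇒x≤y : ∀ {x y} → 0# ≤ y - x → x ≤ y
  0≤y-x⇒x≤y (inj₁ p) = inj₁ (0<y-x⇒x<y p)
  0≤y-x⇒x≤y {x} {y} (inj₂ p) = inj₂ (begin
    x            ≈⟨ +-identityˡ x ⟨
    0# + x       ≈⟨ +-congʳ p ⟩
    y - x + x    ≈⟨ solve 2 (λ x y → y :- x :+ x := y) refl x y ⟩
    y            ∎)

  x≤y⇒0≤y-x : ∀ {x y} → x ≤ y → 0# ≤ y - x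
  x≤y⇒0≤y-x (inj₁ p) = inj₁ (x<y⇒0<y-x p)
  x≤y⇒0≤y-x {x} (inj₂ p) = inj₂ (trans (sym (-‿inverseʳ x)) (+-congʳ p))

  -- Inequalities are proved by exhibiting the difference of the two sides as a positive expression.
  <-by : ∀ {x y z} → 0# < z → z ≈ y - x → x < y
  <-by p eq = 0<y-x⇒x<y (<-respʳ-≈ eq p)

  ≤-by : ∀ {x y z} → 0# ≤ z → z ≈ y - x → x ≤ y
  ≤-by p eq = 0≤y-x⇒x≤y (≤-respʳ-≈ eq p)

  pos+nonneg : ∀ {x y} → 0# < x → 0# ≤ y → 0# < x + y
  pos+nonneg {x} {y} p q = <-≤-trans p (≤-by q (solve 2 (λ x y → y := x :+ y :- x) refl x y))

  nonneg+pos : ∀ {x y} → 0# ≤ x → 0# < y → 0# < x + y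
  nonneg+pos {x} {y} p q = <-respʳ-≈ (+-comm y x) (pos+nonneg q p)

  nonneg+nonneg : ∀ {x y} → 0# ≤ x → 0# ≤ y → 0# ≤ x + y
  nonneg+nonneg (inj₁ p) q = inj₁ (pos+nonneg p q)
  nonneg+nonneg {x} {y} (inj₂ p) q = ≤-respʳ-≈ (trans (sym (+-identityˡ y)) (+-congʳ p)) q

  nonneg*nonneg : ∀ {x y} → 0# ≤ x → 0# ≤ y → 0# ≤ x * y
  nonneg*nonneg (inj₁ p) (inj₁ q) = inj₁ (*-pos p q)
  nonneg*nonneg {x} {y} (inj₂ p) _ = inj₂ (trans (sym (zeroˡ y)) (*-congʳ p))
  nonneg*nonneg {x} {y} _ (inj₂ q) = inj₂ (trans (sym (zeroʳ x)) (*-congˡ q))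

  neg⇒0<- : ∀ {x} → x < 0# → 0# < - x
  neg⇒0<- {x} p = <-respʳ-≈ (+-identityˡ (- x)) (x<y⇒0<y-x p)

  0≤x² : ∀ x → 0# ≤ x * x
  0≤x² x with compare x 0#
  ... | tri< x<0 _ _ = inj₁ (<-respʳ-≈ (solve 1 (λ x → (:- x) :* (:- x) := x :* x) refl x)
                                       (*-pos (neg⇒0<- x<0) (neg⇒0<- x<0)))
  ... | tri≈ _ x≈0 _ = inj₂ (sym (trans (*-congʳ x≈0) (zeroˡ x)))
  ... | tri> _ _ 0<x = inj₁ (*-pos 0<x 0<x)

  0<1 : 0# < 1#
  0<1 with 0≤x² 1#
  ... | inj₁ p = <-respʳ-≈ (*-identityˡ 1#) p
  ... | inj₂ p = contradiction (trans p (*-identityˡ 1#)) 0≉1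

  0<x⇒x≉0 : ∀ {x} → 0# < x → ¬ x ≈ 0#
  0<x⇒x≉0 p eq = <-irrefl (sym eq) p

  *-cancel-0 : ∀ {x y} → ¬ x ≈ 0# → x * y ≈ 0# → y ≈ 0#
  *-cancel-0 {x} {y} x≉0 xy≈0 with inverse x x≉0
  ... | z , xz≈1 = begin
    y            ≈⟨ *-identityˡ y ⟨
    1# * y       ≈⟨ *-congʳ xz≈1 ⟨
    x * z * y    ≈⟨ solve 3 (λ x y z → x :* z :* y := z :* (x :* y)) refl x y z ⟩
    z * (x * y)  ≈⟨ *-congˡ xy≈0 ⟩
    z * 0#       ≈⟨ zeroʳ z ⟩
    0#           ∎

  *-cancel-pos : ∀ {x y} → 0# < x → 0# < x * y → 0# < y
  *-cancel-pos {x} {y} 0<x 0<xy with compare 0# y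
  ... | tri< 0<y _ _ = 0<y
  ... | tri≈ _ 0≈y _ = contradiction (trans (*-congˡ (sym 0≈y)) (zeroʳ x)) (0<x⇒x≉0 0<xy)
  ... | tri> _ _ y<0 = contradiction
    (<-respʳ-≈ (solve 2 (λ x y → x :* y :+ x :* (:- y) := con (0 , 0)) refl x y)
      (pos+nonneg 0<xy (inj₁ (*-pos 0<x (neg⇒0<- y<0)))))
    (<-irrefl refl)

  x-y≈0⇒x≈y : ∀ {x y} → x - y ≈ 0# → x ≈ y
  x-y≈0⇒x≈y {x} {y} p = begin
    x            ≈⟨ solve 2 (λ x y → x := x :- y :+ y) refl x y ⟩
    x - y + y    ≈⟨ +-congʳ p ⟩
    0# + y       ≈⟨ +-identityˡ y ⟩
    y            ∎

-- Finite sums, inner products and linear dependence.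

module LinearAlgebra (ℝ : RealNumbers) where

  open RealNumbers ℝ
  open OrderedField ℝ
  open Convex ℝ
  open import Relation.Binary.Reasoning.Setoid setoid
  private module Σ = SemiringSum semiring

  private
    variable
      m n : ℕ

  sum-cong : {f g : Vector Carrier n} → (∀ i → f i ≈ g i) → sum f ≈ sum g
  sum-cong = Σ.sum-cong-≋

  sum-0 : {f : Vector Carrier n} → (∀ i → f i ≈ 0#) → sum f ≈ 0#
  sum-0 {n} f≈0 = trans (sum-cong f≈0) (Σ.sum-replicate-zero n)

  sum-insertAt : (f : Vector Carrier n) (r : Fin (suc n)) (x : Carrier) → sum (insertAt f r x) ≈ x + sum f
  sum-insertAt f r x = trans (Σ.sum-remove {i = r} (insertAt f r x))
    (+-cong (reflexive (insertAt-lookup f r x)) (sum-cong (λ i → reflexive (insertAt-punchIn f r x i))))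

  sum-updateAt : (f : Vector Carrier n) (r : Fin n) (x : Carrier) →
                 sum (updateAt f r (const x)) ≈ sum f + (x - f r)
  sum-updateAt f zero x =
    solve 3 (λ x y s → x :+ s := y :+ s :+ (x :- y)) refl x (f zero) (sum (tail f))
  sum-updateAt f (suc r) x = trans (+-congˡ (sum-updateAt (tail f) r x)) (sym (+-assoc _ _ _))

  sum-nonneg : {f : Vector Carrier n} → (∀ i → 0# ≤ f i) → 0# ≤ sum f
  sum-nonneg {zero}  p = ≤-refl
  sum-nonneg {suc n} p = nonneg+nonneg (p zero) (sum-nonneg (p ∘ suc))

  zeroAt : Fin n → Vector Carrier n → Vector Carrier n
  zeroAt r f = updateAt f r (const 0#)

  zeroAt-other : (f : Vector Carrier n) {i r : Fin n} → i ≢ r → zeroAt r f i ≈ f i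
  zeroAt-other f i≢r = reflexive (updateAt-minimal _ _ f i≢r)

  zeroAt-nonneg : {f : Vector Carrier n} (r : Fin n) → (∀ i → 0# ≤ f i) → ∀ i → 0# ≤ zeroAt r f i
  zeroAt-nonneg {f = f} r p i with i Fin.≟ r
  ... | yes ≡.refl = ≤-respʳ-≈ (sym (reflexive (updateAt-updates r f))) ≤-refl
  ... | no i≢r     = ≤-respʳ-≈ (sym (zeroAt-other f i≢r)) (p i)

  sum-zeroAt : (f : Vector Carrier n) (r : Fin n) → sum f ≈ f r + sum (zeroAt r f)
  sum-zeroAt f r = sym (trans (+-congˡ (sum-updateAt f r 0#))
    (solve 2 (λ x s → x :+ (s :+ (con (0 , 0) :- x)) := s) refl (f r) (sum f)))

  term≤sum : {f : Vector Carrier n} → (∀ i → 0# ≤ f i) → ∀ r → f r ≤ sum f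
  term≤sum {f = f} p r = ≤-by (sum-nonneg (zeroAt-nonneg r p))
    (trans (solve 2 (λ x s → s := (x :+ s) :- x) refl (f r) _) (+-congʳ (sym (sum-zeroAt f r))))

  pos-term⇒pos-sum : {f : Vector Carrier n} → (∀ i → 0# ≤ f i) → ∀ {r} → 0# < f r → 0# < sum f
  pos-term⇒pos-sum p {r} 0<fr = <-≤-trans 0<fr (term≤sum p r)

  sum≈0⇒term≈0 : {f : Vector Carrier n} → (∀ i → 0# ≤ f i) → sum f ≈ 0# → ∀ r → f r ≈ 0#
  sum≈0⇒term≈0 p eq r with p r
  ... | inj₁ 0<fr = contradiction eq (0<x⇒x≉0 (pos-term⇒pos-sum p 0<fr))
  ... | inj₂ 0≈fr = sym 0≈fr

  two≤sum : {f : Vector Carrier n} → (∀ i → 0# ≤ f i) → ∀ {r s} → s ≢ r → f r + f s ≤ sum f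
  two≤sum {f = f} p {r} {s} s≢r = ≤-respʳ-≈ (sym (sum-zeroAt f r))
    (≤-by (x≤y⇒0≤y-x (term≤sum (zeroAt-nonneg r p) s))
      (trans (+-congˡ (-‿cong (zeroAt-other f s≢r)))
        (solve 3 (λ x y z → z :- y := (x :+ z) :- (x :+ y)) refl (f r) (f s) _)))

  -- Distinct indices claim disjoint shares of the sum; the budget argument for violating pairs
  -- rests on this.
  three≤sum : {f : Vector Carrier n} → (∀ i → 0# ≤ f i) → ∀ {r s t} → s ≢ r → t ≢ r → t ≢ s →
              f r + (f s + f t) ≤ sum f
  three≤sum {f = f} p {r} {s} {t} s≢r t≢r t≢s = ≤-respʳ-≈ (sym (sum-zeroAt f r))
    (≤-by (x≤y⇒0≤y-x (two≤sum (zeroAt-nonneg r p) t≢s))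
      (trans (+-congˡ (-‿cong (+-cong (zeroAt-other f s≢r) (zeroAt-other f t≢r))))
        (solve 3 (λ x y z → z :- y := (x :+ z) :- (x :+ y)) refl (f r) (f s + f t) _)))

  ⟨⟩-cong : {u u′ v v′ : Point n} → u ≋ u′ → v ≋ v′ → ⟨ u , v ⟩ ≈ ⟨ u′ , v′ ⟩
  ⟨⟩-cong u≋u′ v≋v′ = sum-cong (λ i → *-cong (u≋u′ i) (v≋v′ i))

  ⟨⟩-congˡ : (u : Point n) {v v′ : Point n} → v ≋ v′ → ⟨ u , v ⟩ ≈ ⟨ u , v′ ⟩
  ⟨⟩-congˡ u = ⟨⟩-cong {u = u} {u} (λ _ → refl)

  ⟨⟩-congʳ : (v : Point n) {u u′ : Point n} → u ≋ u′ → ⟨ u , v ⟩ ≈ ⟨ u′ , v ⟩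
  ⟨⟩-congʳ v u≋u′ = ⟨⟩-cong {v = v} {v} u≋u′ (λ _ → refl)

  ⟨⟩-comm : (u v : Point n) → ⟨ u , v ⟩ ≈ ⟨ v , u ⟩
  ⟨⟩-comm u v = sum-cong (λ i → *-comm (u i) (v i))

  ⟨⟩-+ˡ : (u u′ v : Point n) → ⟨ (λ i → u i + u′ i) , v ⟩ ≈ ⟨ u , v ⟩ + ⟨ u′ , v ⟩
  ⟨⟩-+ˡ u u′ v = trans (sum-cong (λ i → distribʳ (v i) (u i) (u′ i)))
    (Σ.∑-distrib-+ (λ i → u i * v i) (λ i → u′ i * v i))

  ⟨⟩-*ˡ : (t : Carrier) (u v : Point n) → ⟨ (λ i → t * u i) , v ⟩ ≈ t * ⟨ u , v ⟩
  ⟨⟩-*ˡ t u v = trans (sum-cong (λ i → *-assoc t (u i) (v i)))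
    (sym (Σ.*-distribˡ-sum t (λ i → u i * v i)))

  ⟨⟩-minusˡ : (u u′ v : Point n) → ⟨ (λ i → u i - u′ i) , v ⟩ ≈ ⟨ u , v ⟩ - ⟨ u′ , v ⟩
  ⟨⟩-minusˡ u u′ v = begin
    ⟨ (λ i → u i - u′ i) , v ⟩                 ≈⟨ ⟨⟩-congʳ v (λ i → solve 2 (λ x y → x :- y := x :+ (:- con (1 , 0)) :* y) refl (u i) (u′ i)) ⟩
    ⟨ (λ i → u i + (- 1#) * u′ i) , v ⟩        ≈⟨ ⟨⟩-+ˡ u (λ i → - 1# * u′ i) v ⟩
    ⟨ u , v ⟩ + ⟨ (λ i → (- 1#) * u′ i) , v ⟩  ≈⟨ +-congˡ (⟨⟩-*ˡ (- 1#) u′ v) ⟩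
    ⟨ u , v ⟩ + (- 1#) * ⟨ u′ , v ⟩            ≈⟨ solve 2 (λ x y → x :+ (:- con (1 , 0)) :* y := x :- y) refl _ _ ⟩
    ⟨ u , v ⟩ - ⟨ u′ , v ⟩                     ∎

  ⟨⟩-minusʳ : (u v v′ : Point n) → ⟨ u , (λ i → v i - v′ i) ⟩ ≈ ⟨ u , v ⟩ - ⟨ u , v′ ⟩
  ⟨⟩-minusʳ u v v′ = begin
    ⟨ u , (λ i → v i - v′ i) ⟩   ≈⟨ ⟨⟩-comm u (λ i → v i - v′ i) ⟩
    ⟨ (λ i → v i - v′ i) , u ⟩   ≈⟨ ⟨⟩-minusˡ v v′ u ⟩
    ⟨ v , u ⟩ - ⟨ v′ , u ⟩       ≈⟨ +-cong (⟨⟩-comm v u) (-‿cong (⟨⟩-comm v′ u)) ⟩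
    ⟨ u , v ⟩ - ⟨ u , v′ ⟩       ∎

  ⟨⟩-constʳ : (u : Point n) (x : Carrier) → ⟨ u , (λ _ → x) ⟩ ≈ sum u * x
  ⟨⟩-constʳ u x = sym (Σ.*-distribʳ-sum x u)

  sum-*ˡ : (t : Carrier) (u : Point n) → sum (λ i → t * u i) ≈ t * sum u
  sum-*ˡ t u = sym (Σ.*-distribˡ-sum t u)

  sum-+ : (u v : Point n) → sum (λ i → u i + v i) ≈ sum u + sum v
  sum-+ = Σ.∑-distrib-+

  sum≈⟨⟩1 : (u : Point n) → sum u ≈ ⟨ u , (λ _ → 1#) ⟩
  sum≈⟨⟩1 u = sum-cong (λ i → sym (*-identityʳ (u i)))

  sum-minus : (u v : Point n) → sum (λ i → u i - v i) ≈ sum u - sum v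
  sum-minus u v = begin
    sum (λ i → u i - v i)                                ≈⟨ sum≈⟨⟩1 (λ i → u i - v i) ⟩
    ⟨ (λ i → u i - v i) , (λ _ → 1#) ⟩                   ≈⟨ ⟨⟩-minusˡ u v (λ _ → 1#) ⟩
    ⟨ u , (λ _ → 1#) ⟩ - ⟨ v , (λ _ → 1#) ⟩              ≈⟨ +-cong (sum≈⟨⟩1 u) (-‿cong (sum≈⟨⟩1 v)) ⟨
    sum u - sum v                                        ∎

  -- Exchanges the two summations. It turns a relation among points into a relation among the values
  -- of a functional at these points.
  ⟨⟩-swap : (u : Point m) (v : Point n) (A : Vector (Point n) m) →
            ⟨ u , (λ i → ⟨ v , A i ⟩) ⟩ ≈ ⟨ v , linComb u A ⟩
  ⟨⟩-swap u v A = begin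
    sum (λ i → u i * sum (λ j → v j * A i j))    ≈⟨ sum-cong (λ i → Σ.*-distribˡ-sum (u i) (λ j → v j * A i j)) ⟩
    sum (λ i → sum (λ j → u i * (v j * A i j)))  ≈⟨ Σ.∑-comm (λ i j → u i * (v j * A i j)) ⟩
    sum (λ j → sum (λ i → u i * (v j * A i j)))  ≈⟨ sum-cong (λ j → sum-cong (λ i → solve 3 (λ x y z → x :* (y :* z) := y :* (x :* z)) refl (u i) (v j) (A i j))) ⟩
    sum (λ j → sum (λ i → v j * (u i * A i j)))  ≈⟨ sum-cong (λ j → Σ.*-distribˡ-sum (v j) (λ i → u i * A i j)) ⟨
    sum (λ j → v j * sum (λ i → u i * A i j))    ∎

  ⟨⟩-updateAt : (u v : Point n) (r : Fin n) (x : Carrier) →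
                ⟨ u , updateAt v r (const x) ⟩ ≈ ⟨ u , v ⟩ + u r * (x - v r)
  ⟨⟩-updateAt u v zero x =
    solve 4 (λ a y x s → a :* x :+ s := a :* y :+ s :+ a :* (x :- y)) refl (u zero) (v zero) x _
  ⟨⟩-updateAt u v (suc r) x = trans (+-congˡ (⟨⟩-updateAt (tail u) (tail v) r x)) (sym (+-assoc _ _ _))

  unit : Fin n → Point n
  unit r = updateAt (λ _ → 0#) r (const 1#)

  ⟨⟩-unitʳ : (u : Point n) (r : Fin n) → ⟨ u , unit r ⟩ ≈ u r
  ⟨⟩-unitʳ u r = begin
    ⟨ u , unit r ⟩                           ≈⟨ ⟨⟩-updateAt u (λ _ → 0#) r 1# ⟩
    ⟨ u , (λ _ → 0#) ⟩ + u r * (1# - 0#)     ≈⟨ +-congʳ (⟨⟩-constʳ u 0#) ⟩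
    sum u * 0# + u r * (1# - 0#)             ≈⟨ solve 2 (λ s x → s :* con (0 , 0) :+ x :* (con (1 , 0) :- con (0 , 0)) := x) refl (sum u) (u r) ⟩
    u r                                      ∎

  ⟨⟩-unitˡ : (u : Point n) (r : Fin n) → ⟨ unit r , u ⟩ ≈ u r
  ⟨⟩-unitˡ u r = trans (⟨⟩-comm (unit r) u) (⟨⟩-unitʳ u r)

  sum-unit : (r : Fin n) → sum (unit r) ≈ 1#
  sum-unit r = trans (sum≈⟨⟩1 (unit r)) (⟨⟩-unitˡ (λ _ → 1#) r)

  unit-nonneg : (r i : Fin n) → 0# ≤ unit r i
  unit-nonneg r i with i Fin.≟ r
  ... | yes ≡.refl = ≤-respʳ-≈ (sym (reflexive (updateAt-updates r (λ _ → 0#)))) (inj₁ 0<1)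
  ... | no i≢r     = ≤-respʳ-≈ (sym (reflexive (updateAt-minimal i r (λ _ → 0#) i≢r))) ≤-refl

  -- Gaussian elimination of the first coordinate.
  dependent : (A : Vector (Point n) (suc n)) →
              ∃[ c ] (∃[ i ] ¬ c i ≈ 0#) × linComb c A ≋ replicate n 0#
  dependent {zero}  A = (λ _ → 1#) , (zero , λ 1≈0 → 0≉1 (sym 1≈0)) , λ ()
  dependent {suc n} A with any? (λ i → ¬? (A i zero ≟ 0#))
  ... | no allZero =
    let c , (i , ci≉0) , cB≈0 = dependent (λ i j → A (suc i) (suc j))
    in (0# ∷ c) , (suc i , ci≉0) , λ where
      zero    → sum-0 {f = λ i → (0# ∷ c) i * A i zero} λ i →
        trans (*-congˡ (decidable-stable (A i zero ≟ 0#) (λ p → allZero (i , p)))) (zeroʳ _)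
      (suc j) → trans (+-cong (zeroˡ _) (cB≈0 j)) (+-identityˡ 0#)
  ... | yes (r , pivot≉0) = c , (punchIn r i , ci≉0) , λ where
      zero    → trans (column zero) (solve 2 (λ α s → (:- s) :* α :+ α :* s := con (0 , 0)) refl α s)
      (suc j) → begin
        linComb c A (suc j)                         ≈⟨ column (suc j) ⟩
        (- s) * A r (suc j) + α * ⟨ c′ , rest (suc j) ⟩
          ≈⟨ solve 4 (λ s x α t → (:- s) :* x :+ α :* t := α :* t :- x :* s) refl s (A r (suc j)) α _ ⟩
        α * ⟨ c′ , rest (suc j) ⟩ - A r (suc j) * s
          ≈⟨ +-cong (scale α (rest (suc j))) (-‿cong (scale (A r (suc j)) (rest zero))) ⟨
        ⟨ c′ , (λ i → α * rest (suc j) i) ⟩ - ⟨ c′ , (λ i → A r (suc j) * rest zero i) ⟩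
          ≈⟨ ⟨⟩-minusʳ c′ (λ i → α * rest (suc j) i) (λ i → A r (suc j) * rest zero i) ⟨
        linComb c′ B j                              ≈⟨ c′B≈0 j ⟩
        0#                                          ∎
    where
    α = A r zero
    rest : Fin (suc n) → Point (suc n)
    rest j i = A (punchIn r i) j
    -- Each remaining row is cross-multiplied with the pivot row, so its first entry cancels without
    -- division.
    B : Vector (Point n) (suc n)
    B i j = α * rest (suc j) i - A r (suc j) * rest zero i
    ih = dependent B
    c′ = proj₁ ih
    i = proj₁ (proj₁ (proj₂ ih))
    c′B≈0 = proj₂ (proj₂ ih)
    s = ⟨ c′ , rest zero ⟩
    -- The pivot row absorbs what the other rows leave in the first column: they contribute α s
    -- there, the pivot row - s α.
    c : Point (suc (suc n))
    c = insertAt (λ i → α * c′ i) r (- s)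
    ci≉0 : ¬ c (punchIn r i) ≈ 0#
    ci≉0 eq = proj₂ (proj₁ (proj₂ ih))
      (*-cancel-0 pivot≉0 (trans (reflexive (≡.sym (insertAt-punchIn (λ i → α * c′ i) r (- s) i))) eq))
    scale : ∀ t v → ⟨ c′ , (λ i → t * v i) ⟩ ≈ t * ⟨ c′ , v ⟩
    scale t v = trans (⟨⟩-comm c′ (λ i → t * v i)) (trans (⟨⟩-*ˡ t v c′) (*-congˡ (⟨⟩-comm v c′)))
    column : ∀ j → linComb c A j ≈ (- s) * A r j + α * ⟨ c′ , rest j ⟩
    column j = begin
      sum (λ k → c k * A k j)
        ≈⟨ Σ.sum-remove {i = r} (λ k → c k * A k j) ⟩
      c r * A r j + sum (λ k → c (punchIn r k) * rest j k)
        ≈⟨ +-cong (*-congʳ (reflexive (insertAt-lookup (λ i → α * c′ i) r (- s))))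
                  (sum-cong (λ k → *-congʳ {x = rest j k} (reflexive (insertAt-punchIn (λ i → α * c′ i) r (- s) k)))) ⟩
      (- s) * A r j + ⟨ (λ k → α * c′ k) , rest j ⟩
        ≈⟨ +-congˡ (⟨⟩-*ˡ α c′ (rest j)) ⟩
      (- s) * A r j + α * ⟨ c′ , rest j ⟩  ∎

-- Affine relations, hulls and affine coordinates.

module AffineGeometry (ℝ : RealNumbers) where

  open RealNumbers ℝ
  open OrderedField ℝ
  open Convex ℝ
  open LinearAlgebra ℝ
  open import Relation.Binary.Reasoning.Setoid setoid

  private
    variable
      d m n : ℕ

  ≋-refl : {u : Point n} → u ≋ u
  ≋-refl _ = refl

  ≋-sym : {u v : Point n} → u ≋ v → v ≋ u
  ≋-sym p i = sym (p i)

  ≋-trans : {u v w : Point n} → u ≋ v → v ≋ w → u ≋ w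
  ≋-trans p q i = trans (p i) (q i)

  ⟨linComb⟩ : (u : Point m) (A : Vector (Point n) m) (v : Point n) →
              ⟨ linComb u A , v ⟩ ≈ ⟨ u , (λ i → ⟨ A i , v ⟩) ⟩
  ⟨linComb⟩ u A v = begin
    ⟨ linComb u A , v ⟩           ≈⟨ ⟨⟩-comm (linComb u A) v ⟩
    ⟨ v , linComb u A ⟩           ≈⟨ ⟨⟩-swap u v A ⟨
    ⟨ u , (λ i → ⟨ v , A i ⟩) ⟩   ≈⟨ ⟨⟩-congˡ u (λ i → ⟨⟩-comm v (A i)) ⟩
    ⟨ u , (λ i → ⟨ A i , v ⟩) ⟩   ∎

  sum-linComb : (u : Point m) (A : Vector (Point n) m) → sum (linComb u A) ≈ ⟨ u , (λ i → sum (A i)) ⟩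
  sum-linComb u A = begin
    sum (linComb u A)                     ≈⟨ sum≈⟨⟩1 (linComb u A) ⟩
    ⟨ linComb u A , (λ _ → 1#) ⟩          ≈⟨ ⟨linComb⟩ u A (λ _ → 1#) ⟩
    ⟨ u , (λ i → ⟨ A i , (λ _ → 1#) ⟩) ⟩  ≈⟨ ⟨⟩-congˡ u (λ i → sum≈⟨⟩1 (A i)) ⟨
    ⟨ u , (λ i → sum (A i)) ⟩             ∎

  linComb-congʳ : (u : Point m) {A B : Vector (Point n) m} → (∀ i → A i ≋ B i) → linComb u A ≋ linComb u B
  linComb-congʳ u A≋B c = ⟨⟩-congˡ u (λ i → A≋B i c)

  linComb-linComb : (u : Point m) (V : Vector (Point n) m) (A : Vector (Point d) n) →
                    linComb u (λ i → linComb (V i) A) ≋ linComb (linComb u V) A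
  linComb-linComb u V A c = sym (⟨linComb⟩ u V (λ k → A k c))

  linComb-unit : (r : Fin m) (A : Vector (Point n) m) → linComb (unit r) A ≋ A r
  linComb-unit r A c = ⟨⟩-unitˡ (λ i → A i c) r

  unit-sym : (r i : Fin n) → unit r i ≡ unit i r
  unit-sym zero    zero    = ≡.refl
  unit-sym zero    (suc i) = ≡.refl
  unit-sym (suc r) zero    = ≡.refl
  unit-sym (suc r) (suc i) = unit-sym r i

  linComb-units : (u : Point n) → linComb u unit ≋ u
  linComb-units u c = trans (⟨⟩-congˡ u (λ i → reflexive (unit-sym i c))) (⟨⟩-unitʳ u c)

  -- Unlike in `aff` and `conv`, the weights refer to one fixed family e, so they can be paired with
  -- a vector of values at e.
  AffineHull ConvexHull : Vector (Point d) n → Subset d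
  AffineHull {n = n} e p = Σ[ w ∈ Point n ] sum w ≈ 1# × p ≋ linComb w e
  ConvexHull {n = n} e p = Σ[ w ∈ Point n ] (∀ i → 0# ≤ w i) × sum w ≈ 1# × p ≋ linComb w e

  ConvexHull⊆conv-range : {e : Vector (Point d) n} → ConvexHull e ⊆ conv (range e)
  ConvexHull⊆conv-range {n = n} {e} (w , w≥0 , Σw≈1 , p≋) = n , e , w , (λ i → i , ≋-refl) , w≥0 , Σw≈1 , p≋

  AffineHull⊆aff-range : {e : Vector (Point d) n} → AffineHull e ⊆ aff (range e)
  AffineHull⊆aff-range {n = n} {e} (w , Σw≈1 , p≋) = n , e , w , (λ i → i , ≋-refl) , Σw≈1 , p≋

  range⊆AffineHull : {e : Vector (Point d) n} → range e ⊆ AffineHull e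
  range⊆AffineHull {e = e} (i , p≋) = unit i , sum-unit i , ≋-trans p≋ (≋-sym (linComb-unit i e))

  range⊆ConvexHull : {e : Vector (Point d) n} → range e ⊆ ConvexHull e
  range⊆ConvexHull {e = e} (i , p≋) =
    unit i , unit-nonneg i , sum-unit i , ≋-trans p≋ (≋-sym (linComb-unit i e))

  sum-linComb-1 : (w : Point m) (V : Vector (Point n) m) → sum w ≈ 1# → (∀ i → sum (V i) ≈ 1#) →
                  sum (linComb w V) ≈ 1#
  sum-linComb-1 w V Σw≈1 ΣV≈1 = begin
    sum (linComb w V)           ≈⟨ sum-linComb w V ⟩
    ⟨ w , (λ i → sum (V i)) ⟩   ≈⟨ ⟨⟩-congˡ w ΣV≈1 ⟩
    ⟨ w , (λ _ → 1#) ⟩          ≈⟨ sum≈⟨⟩1 w ⟨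
    sum w                       ≈⟨ Σw≈1 ⟩
    1#                          ∎

  aff⊆AffineHull : {S : Subset d} {e : Vector (Point d) n} → S ⊆ AffineHull e → aff S ⊆ AffineHull e
  aff⊆AffineHull {e = e} S⊆ (m , y , w , y∈S , Σw≈1 , p≋) =
    linComb w V , sum-linComb-1 w V Σw≈1 (λ i → proj₁ (proj₂ (S⊆ (y∈S i)))) ,
    ≋-trans p≋ (≋-trans (linComb-congʳ w (λ i → proj₂ (proj₂ (S⊆ (y∈S i))))) (linComb-linComb w V e))
    where V = λ i → proj₁ (S⊆ (y∈S i))

  conv⊆ConvexHull : {S : Subset d} {e : Vector (Point d) n} → S ⊆ ConvexHull e → conv S ⊆ ConvexHull e
  conv⊆ConvexHull {e = e} S⊆ (m , y , w , y∈S , w≥0 , Σw≈1 , p≋) =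
    linComb w V ,
    (λ k → sum-nonneg (λ i → nonneg*nonneg (w≥0 i) (proj₁ (proj₂ (S⊆ (y∈S i))) k))) ,
    sum-linComb-1 w V Σw≈1 (λ i → proj₁ (proj₂ (proj₂ (S⊆ (y∈S i))))) ,
    ≋-trans p≋ (≋-trans (linComb-congʳ w (λ i → proj₂ (proj₂ (proj₂ (S⊆ (y∈S i)))))) (linComb-linComb w V e))
    where V = λ i → proj₁ (S⊆ (y∈S i))

  aff-mono : {S S′ : Subset d} → S ⊆ S′ → aff S ⊆ aff S′
  aff-mono S⊆S′ (m , y , w , y∈S , rest) = m , y , w , (λ i → S⊆S′ (y∈S i)) , rest

  S⊆conv : {S : Subset d} → S ⊆ conv S
  S⊆conv {S = S} {p} p∈S = 1 , (λ _ → p) , (λ _ → 1#) , (λ _ → p∈S) , (λ _ → inj₁ 0<1) ,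
    +-identityʳ 1# , λ c → sym (trans (+-identityʳ _) (*-identityˡ _))

  IsRelation : Vector (Point d) n → Point n → Set
  IsRelation {d} e u = sum u ≈ 0# × linComb u e ≋ replicate d 0#

  -- The extra coordinate 1 records the sum of the coefficients, so linear relations among the
  -- lifted points are the affine relations among the points.
  homogeneous : Point d → Point (suc d)
  homogeneous p = 1# ∷ p

  abstract
    nontrivialRelation : (e : Vector (Point d) (suc (suc d))) →
                         Σ[ u ∈ Point (suc (suc d)) ] (∃[ i ] ¬ u i ≈ 0#) × IsRelation e u
    nontrivialRelation e =
      let u , nonzero , eq = dependent (λ i → homogeneous (e i))
      in u , nonzero , trans (sum≈⟨⟩1 u) (eq zero) , λ c → eq (suc c)

  -- Divide the relation by the coefficient of p and move the rest to the other side; the new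
  -- weights sum to 1 because the old ones sum to 0.
  solveForHead : {p : Point d} (e : Vector (Point d) n) (w : Point (suc n)) →
                 ¬ w zero ≈ 0# → IsRelation (p ∷ e) w → p ∈ AffineHull e
  solveForHead {p = p} e w w₀≉0 (Σw≈0 , we≈0) with inverse (w zero) w₀≉0
  ... | z , w₀z≈1 = v , Σv≈1 , p≋
    where
    v = λ k → (- z) * w (suc k)
    Σv≈1 = begin
      sum v                            ≈⟨ sum-*ˡ (- z) (tail w) ⟩
      (- z) * sum (tail w)             ≈⟨ solve 3 (λ z x s → (:- z) :* s := (:- z) :* (x :+ s) :+ x :* z) refl z (w zero) (sum (tail w)) ⟩
      (- z) * sum w + w zero * z       ≈⟨ +-cong (*-congˡ Σw≈0) w₀z≈1 ⟩
      (- z) * 0# + 1#                  ≈⟨ solve 1 (λ z → (:- z) :* con (0 , 0) :+ con (1 , 0) := con (1 , 0)) refl z ⟩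
      1#                               ∎
    p≋ : p ≋ linComb v e
    p≋ c = sym (begin
      linComb v e c                       ≈⟨ ⟨⟩-*ˡ (- z) (tail w) (λ k → e k c) ⟩
      (- z) * linComb (tail w) e c        ≈⟨ solve 4 (λ z x s q → (:- z) :* s := (:- z) :* (x :* q :+ s) :+ x :* z :* q) refl z (w zero) (linComb (tail w) e c) (p c) ⟩
      (- z) * linComb w (p ∷ e) c + w zero * z * p c
                                          ≈⟨ +-cong (*-congˡ (we≈0 c)) (*-congʳ w₀z≈1) ⟩
      (- z) * 0# + 1# * p c               ≈⟨ solve 2 (λ z q → (:- z) :* con (0 , 0) :+ con (1 , 0) :* q := q) refl z (p c) ⟩
      p c                                 ∎)

  tailRelation : {p : Point d} (e : Vector (Point d) n) (w : Point (suc n)) →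
                 w zero ≈ 0# → IsRelation (p ∷ e) w → IsRelation e (tail w)
  tailRelation {p = p} e w w₀≈0 (Σw≈0 , we≈0) =
    trans (sym (trans (+-congʳ w₀≈0) (+-identityˡ _))) Σw≈0 ,
    λ c → trans (sym (trans (+-congʳ (trans (*-congʳ w₀≈0) (zeroˡ (p c)))) (+-identityˡ _))) (we≈0 c)

  -- Adding p makes d + 2 points, which are always related; the coefficient of p is nonzero, as
  -- otherwise e itself would be dependent.
  independent⇒spanning : {e : Vector (Point d) (suc d)} → AffinelyIndependent e → Universal (AffineHull e)
  independent⇒spanning {e = e} indep p with nontrivialRelation (p ∷ e)
  ... | w , (i , wi≉0) , rel with w zero ≟ 0#
  ...   | no w₀≉0  = solveForHead e w w₀≉0 rel
  ...   | yes w₀≈0 = contradiction (w≈0 i) wi≉0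
    where
    w≈0 : ∀ i → w i ≈ 0#
    w≈0 zero    = w₀≈0
    w≈0 (suc i) = let Σ≈0 , we≈0 = tailRelation e w w₀≈0 rel in indep (tail w) Σ≈0 we≈0 i

  -- A relation involving v could be solved for v and would place it in `aff S`. Every apex of a
  -- pyramid thus enlarges an affine basis.
  independent-∷ : {S : Subset d} {v : Point d} {e : Vector (Point d) n} →
                  AffinelyIndependent e → (∀ i → e i ∈ S) → v ∉ aff S → AffinelyIndependent (v ∷ e)
  independent-∷ {n = n} {v = v} {e} indep e∈S v∉ w Σw≈0 we≈0 with w zero ≟ 0#
  ... | yes w₀≈0 = λ where
    zero    → w₀≈0
    (suc i) → let Σ≈0 , we≈0 = tailRelation e w w₀≈0 (Σw≈0 , we≈0) in indep (tail w) Σ≈0 we≈0 i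
  ... | no w₀≉0 = contradiction
    (let u , Σu≈1 , v≋ = solveForHead e w w₀≉0 (Σw≈0 , we≈0) in n , e , u , e∈S , Σu≈1 , v≋) v∉

  -- The barycentric weights of a point are chosen to depend affinely on it.
  record Coordinates (e : Vector (Point d) n) : Set where
    field
      origin     : Point n
      direction  : Vector (Point n) d
      sum-origin : sum origin ≈ 1#
      at-origin  : linComb origin e ≋ replicate d 0#
      sum-direction : ∀ c → sum (direction c) ≈ 0#
      at-direction  : ∀ c → linComb (direction c) e ≋ unit c

    coordinates : Point d → Point n
    coordinates p k = origin k + linComb p direction k

    ⟨coordinates⟩ : ∀ p y → ⟨ coordinates p , y ⟩ ≈ ⟨ origin , y ⟩ + ⟨ p , (λ c → ⟨ direction c , y ⟩) ⟩
    ⟨coordinates⟩ p y = trans (⟨⟩-+ˡ origin (linComb p direction) y) (+-congˡ (⟨linComb⟩ p direction y))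

    sum-coordinates : ∀ p → sum (coordinates p) ≈ 1#
    sum-coordinates p = begin
      sum (coordinates p)                          ≈⟨ sum-+ origin (linComb p direction) ⟩
      sum origin + sum (linComb p direction)       ≈⟨ +-cong sum-origin (sum-linComb p direction) ⟩
      1# + ⟨ p , (λ c → sum (direction c)) ⟩       ≈⟨ +-congˡ (trans (⟨⟩-congˡ p sum-direction) (⟨⟩-constʳ p 0#)) ⟩
      1# + sum p * 0#                              ≈⟨ solve 1 (λ s → con (1 , 0) :+ s :* con (0 , 0) := con (1 , 0)) refl (sum p) ⟩
      1#                                           ∎

    linComb-coordinates : ∀ p → linComb (coordinates p) e ≋ p
    linComb-coordinates p c = begin
      linComb (coordinates p) e c                                ≈⟨ ⟨coordinates⟩ p (λ k → e k c) ⟩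
      linComb origin e c + ⟨ p , (λ b → linComb (direction b) e c) ⟩
        ≈⟨ +-cong (at-origin c) (⟨⟩-congˡ p (λ b → at-direction b c)) ⟩
      0# + linComb p unit c                                      ≈⟨ +-identityˡ _ ⟩
      linComb p unit c                                           ≈⟨ linComb-units p c ⟩
      p c                                                        ∎

  -- Weights chosen for the origin and the unit vectors extend affinely to all points; differences
  -- of two such choices give the directions.
  spanning⇒Coordinates : {e : Vector (Point d) n} → Universal (AffineHull e) → Coordinates e
  spanning⇒Coordinates {d} {e = e} span = record
    { origin        = w₀
    ; direction     = λ c k → w c k - w₀ k
    ; sum-origin    = proj₁ (proj₂ (span (replicate d 0#)))
    ; at-origin     = w₀e≈0
    ; sum-direction = λ c → trans (sum-minus (w c) w₀)
        (trans (+-cong (proj₁ (proj₂ (span (unit c)))) (-‿cong (proj₁ (proj₂ (span (replicate d 0#)))))) (-‿inverseʳ 1#))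
    ; at-direction  = λ c b → trans (⟨⟩-minusˡ (w c) w₀ (λ k → e k b))
        (trans (+-cong (sym (proj₂ (proj₂ (span (unit c))) b)) (-‿cong (w₀e≈0 b)))
          (solve 1 (λ x → x :- con (0 , 0) := x) refl (unit c b)))
    }
    where
    w₀ = proj₁ (span (replicate d 0#))
    w = λ c → proj₁ (span (unit c))
    w₀e≈0 : linComb w₀ e ≋ replicate d 0#
    w₀e≈0 = ≋-sym (proj₂ (proj₂ (span (replicate d 0#))))

  module _ {e : Vector (Point d) (suc (suc d))} (frame : Coordinates e)
           {ρ : Point (suc (suc d))} (rel : IsRelation e ρ) {r : Fin (suc (suc d))} (ρr≉0 : ¬ ρ r ≈ 0#) where

    open Coordinates frame

    -- Two relations together with the origin and direction vectors are too many to be independent.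
    relations-proportional : ∀ {u} → IsRelation e u → ∃[ t ] ∀ k → u k ≈ t * ρ k
    relations-proportional {u} (Σu≈0 , ue≈0) with dependent (u ∷ ρ ∷ origin ∷ direction)
    ... | c , (i , ci≉0) , eq = (- z) * c (suc zero) , λ k → begin
      u k                                                   ≈⟨ solve 4 (λ u c z l → u := z :* (c :* u :+ l) :- z :* l :+ (con (1 , 0) :- c :* z) :* u) refl
                                                                 (u k) (c zero) z (c (suc zero) * ρ k) ⟩
      z * (c zero * u k + c (suc zero) * ρ k) - z * (c (suc zero) * ρ k) + (1# - c zero * z) * u k
        ≈⟨ +-cong (+-congʳ (*-congˡ (reduced k))) (*-congʳ (+-congˡ (-‿cong c₀z≈1))) ⟩
      z * 0# - z * (c (suc zero) * ρ k) + (1# - 1#) * u k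
        ≈⟨ solve 4 (λ u z c l → z :* con (0 , 0) :- z :* (c :* l) :+ (con (1 , 0) :- con (1 , 0)) :* u := (:- z) :* c :* l) refl
             (u k) z (c (suc zero)) (ρ k) ⟩
      (- z) * c (suc zero) * ρ k                           ∎
      where
      γ = λ b → c (suc (suc (suc b)))
      vectors = u ∷ ρ ∷ origin ∷ direction
      c₂ = c (suc (suc zero))
      -- Summing the entries isolates the origin vector: it has sum 1, the relations and the
      -- directions have sum 0.
      c₂≈0 : c₂ ≈ 0#
      c₂≈0 = begin
        c₂  ≈⟨ solve 4 (λ a b z s → z := a :* con (0 , 0) :+ (b :* con (0 , 0) :+ (z :* con (1 , 0) :+ s :* con (0 , 0)))) refl
                 (c zero) (c (suc zero)) c₂ (sum γ) ⟩
        c zero * 0# + (c (suc zero) * 0# + (c₂ * 1# + sum γ * 0#))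
            ≈⟨ +-cong (*-congˡ Σu≈0) (+-cong (*-congˡ (proj₁ rel)) (+-cong (*-congˡ sum-origin)
                 (trans (⟨⟩-congˡ γ sum-direction) (⟨⟩-constʳ γ 0#)))) ⟨
        ⟨ c , (λ i → sum (vectors i)) ⟩  ≈⟨ sum-linComb c vectors ⟨
        sum (linComb c vectors)          ≈⟨ sum-0 eq ⟩
        0#                               ∎
      -- Combining the points e with these vectors isolates the directions: the relations and the
      -- origin vector give 0, the directions give the unit vectors.
      γ≈0 : ∀ b → γ b ≈ 0#
      γ≈0 b = begin
        γ b  ≈⟨ linComb-units γ b ⟨
        linComb γ unit b
          ≈⟨ solve 4 (λ a b z s → s := a :* con (0 , 0) :+ (b :* con (0 , 0) :+ (z :* con (0 , 0) :+ s))) refl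
               (c zero) (c (suc zero)) c₂ _ ⟩
        c zero * 0# + (c (suc zero) * 0# + (c₂ * 0# + linComb γ unit b))
            ≈⟨ +-cong (*-congˡ (ue≈0 b)) (+-cong (*-congˡ (proj₂ rel b)) (+-cong (*-congˡ (at-origin b))
                 (⟨⟩-congˡ γ (λ a → at-direction a b)))) ⟨
        ⟨ c , (λ i → linComb (vectors i) e b) ⟩  ≈⟨ ⟨linComb⟩ c vectors (λ k → e k b) ⟨
        ⟨ linComb c vectors , (λ k → e k b) ⟩    ≈⟨ sum-0 (λ k → trans (*-congʳ {x = e k b} (eq k)) (zeroˡ _)) ⟩
        0#                                       ∎
      reduced : ∀ k → c zero * u k + c (suc zero) * ρ k ≈ 0#
      reduced k = begin
        c zero * u k + c (suc zero) * ρ k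
          ≈⟨ solve 3 (λ x y z → x :+ y := x :+ (y :+ (con (0 , 0) :* z :+ con (0 , 0)))) refl _ _ (origin k) ⟩
        c zero * u k + (c (suc zero) * ρ k + (0# * origin k + 0#))
          ≈⟨ +-congˡ (+-congˡ (+-cong (*-congʳ c₂≈0) (sum-0 (λ b → trans (*-congʳ (γ≈0 b)) (zeroˡ _))))) ⟨
        linComb c vectors k  ≈⟨ eq k ⟩
        0#                   ∎
      -- If u dropped out, what remains at r is c₁ ρ r = 0 with ρ r nonzero, so the whole
      -- combination would be trivial.
      c₀≉0 : ¬ c zero ≈ 0#
      c₀≉0 c₀≈0 = ci≉0 (c≈0 i)
        where
        c₁≈0 : c (suc zero) ≈ 0#
        c₁≈0 = *-cancel-0 ρr≉0 (trans (*-comm _ _)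
          (trans (sym (trans (+-congʳ (trans (*-congʳ c₀≈0) (zeroˡ _))) (+-identityˡ _))) (reduced r)))
        c≈0 : ∀ i → c i ≈ 0#
        c≈0 zero                = c₀≈0
        c≈0 (suc zero)          = c₁≈0
        c≈0 (suc (suc zero))    = c₂≈0
        c≈0 (suc (suc (suc b))) = γ≈0 b
      z = proj₁ (inverse (c zero) c₀≉0)
      c₀z≈1 = proj₂ (inverse (c zero) c₀≉0)

    abstract
      -- The affine function is p ↦ ⟨ coordinates p , y ⟩. At e k the chosen weights may differ from
      -- `unit k`, but the difference is a relation, hence a multiple of ρ, and y annihilates it.
      realise : ∀ y → ⟨ ρ , y ⟩ ≈ 0# → ∃[ normal ] ∃[ shift ] ∀ k → ⟨ normal , e k ⟩ + shift ≈ y k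
      realise y ρy≈0 = (λ c → ⟨ direction c , y ⟩) , ⟨ origin , y ⟩ , λ k →
        let t , u≈tρ = relations-proportional {λ i → unit k i - coordinates (e k) i}
              ( trans (sum-minus (unit k) (coordinates (e k)))
                  (trans (+-cong (sum-unit k) (-‿cong (sum-coordinates (e k)))) (-‿inverseʳ 1#))
              , λ c → trans (⟨⟩-minusˡ (unit k) (coordinates (e k)) (λ i → e i c))
                  (trans (+-cong (linComb-unit k e c) (-‿cong (linComb-coordinates (e k) c))) (-‿inverseʳ _)))
        in begin
          ⟨ (λ c → ⟨ direction c , y ⟩) , e k ⟩ + ⟨ origin , y ⟩
            ≈⟨ trans (+-comm _ _) (+-congˡ (⟨⟩-comm (λ c → ⟨ direction c , y ⟩) (e k))) ⟩
          ⟨ origin , y ⟩ + ⟨ e k , (λ c → ⟨ direction c , y ⟩) ⟩  ≈⟨ ⟨coordinates⟩ (e k) y ⟨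
          ⟨ coordinates (e k) , y ⟩                               ≈⟨ x-y≈0⇒x≈y (begin
            ⟨ unit k , y ⟩ - ⟨ coordinates (e k) , y ⟩                ≈⟨ ⟨⟩-minusˡ (unit k) (coordinates (e k)) y ⟨
            ⟨ (λ i → unit k i - coordinates (e k) i) , y ⟩           ≈⟨ ⟨⟩-congʳ y u≈tρ ⟩
            ⟨ (λ i → t * ρ i) , y ⟩                                 ≈⟨ ⟨⟩-*ˡ t ρ y ⟩
            t * ⟨ ρ , y ⟩                                           ≈⟨ *-congˡ ρy≈0 ⟩
            t * 0#                                                   ≈⟨ zeroʳ t ⟩
            0#                                                       ∎) ⟨
          ⟨ unit k , y ⟩                                          ≈⟨ ⟨⟩-unitˡ y k ⟩
          y k                                                     ∎

-- The affine dependence and level vectors balanced by it.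

module Circuits (ℝ : RealNumbers) where

  open RealNumbers ℝ
  open OrderedField ℝ
  open Convex ℝ
  open LinearAlgebra ℝ
  open AffineGeometry ℝ
  open import Relation.Binary.Reasoning.Setoid setoid

  private
    variable
      d m n : ℕ

  pos-sum⇒pos-term : {f : Vector Carrier n} → (∀ i → 0# ≤ f i) → 0# < sum f → ∃[ k ] 0# < f k
  pos-sum⇒pos-term {f = f} f≥0 0<Σ with any? (λ k → 0# <? f k)
  ... | yes p = p
  ... | no ¬p = contradiction (sum-0 f≈0) (0<x⇒x≉0 0<Σ)
    where
    f≈0 : ∀ k → f k ≈ 0#
    f≈0 k with f≥0 k
    ... | inj₁ 0<fk = contradiction (k , 0<fk) ¬p
    ... | inj₂ 0≈fk = sym 0≈fk

  -- Removing f i leaves a positive sum, which has a positive term. In this form the vertex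
  -- condition says that either sign survives the deletion of any point.
  term<sum⇒another : {f : Vector Carrier n} → (∀ i → 0# ≤ f i) → ∀ {i} → f i < sum f →
                     ∃[ k ] k ≢ i × 0# < f k
  term<sum⇒another {f = f} f≥0 {i} fi<Σ
    with pos-sum⇒pos-term (zeroAt-nonneg i f≥0)
           (<-respʳ-≈ (trans (+-congʳ (sum-zeroAt f i)) (solve 2 (λ x y → x :+ y :- x := y) refl (f i) _)) (x<y⇒0<y-x fi<Σ))
  ... | k , 0<zero with k Fin.≟ i
  ...   | yes ≡.refl = contradiction (reflexive (updateAt-updates i f)) (0<x⇒x≉0 0<zero)
  ...   | no k≢i     = k , k≢i , <-respʳ-≈ (zeroAt-other f k≢i) 0<zero

  another⇒term<sum : {f : Vector Carrier n} → (∀ i → 0# ≤ f i) → ∀ {i} →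
                     (∃[ k ] k ≢ i × 0# < f k) → f i < sum f
  another⇒term<sum {f = f} f≥0 {i} (k , k≢i , 0<fk) =
    <-≤-trans (<-by 0<fk (solve 2 (λ x y → y := x :+ y :- x) refl (f i) (f k))) (two≤sum f≥0 k≢i)

  -- The affine dependence Σ aᵢ eᵢ = Σ bᵢ eᵢ with its positive and negative parts separated;
  -- the last two conditions say that at least two coefficients have either sign.
  record Circuit (e : Vector (Point d) n) : Set where
    field
      a b      : Point n
      a≥0      : ∀ i → 0# ≤ a i
      b≥0      : ∀ i → 0# ≤ b i
      disjoint : ∀ i → a i ≈ 0# ⊎ b i ≈ 0#
      sum-a≈b  : sum a ≈ sum b
      comb-a≋b : linComb a e ≋ linComb b e
      a<sum    : ∀ i → a i < sum a
      b<sum    : ∀ i → b i < sum b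

    relation : IsRelation e (λ i → a i - b i)
    relation =
      trans (sum-minus a b) (trans (+-congˡ (-‿cong (sym sum-a≈b))) (-‿inverseʳ _)) ,
      λ c → trans (⟨⟩-minusˡ a b (λ i → e i c)) (trans (+-congˡ (-‿cong (sym (comb-a≋b c)))) (-‿inverseʳ _))

    b<sum-a : ∀ i → b i < sum a
    b<sum-a i = <-respʳ-≈ (sym sum-a≈b) (b<sum i)

    a-another : ∀ i → ∃[ k ] k ≢ i × 0# < a k
    a-another i = term<sum⇒another a≥0 (a<sum i)

    b-another : ∀ i → ∃[ k ] k ≢ i × 0# < b k
    b-another i = term<sum⇒another b≥0 (b<sum i)

    0<a⇒b≈0 : ∀ {i} → 0# < a i → b i ≈ 0#
    0<a⇒b≈0 {i} 0<a with disjoint i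
    ... | inj₁ a≈0 = contradiction a≈0 (0<x⇒x≉0 0<a)
    ... | inj₂ b≈0 = b≈0

    0<b⇒a≈0 : ∀ {i} → 0# < b i → a i ≈ 0#
    0<b⇒a≈0 {i} 0<b with disjoint i
    ... | inj₁ a≈0 = a≈0
    ... | inj₂ b≈0 = contradiction b≈0 (0<x⇒x≉0 0<b)

    nontrivial : Fin n → ∃[ k ] ¬ a k - b k ≈ 0#
    nontrivial i with a-another i
    ... | k , _ , 0<a = k , λ eq → 0<x⇒x≉0 0<a (trans (x-y≈0⇒x≈y eq) (0<a⇒b≈0 0<a))

    -- Pairs a functional with both sides of the dependence; `realise` is the converse.
    affine-balance : ∀ u → ⟨ a , (λ k → ⟨ u , e k ⟩) ⟩ ≈ ⟨ b , (λ k → ⟨ u , e k ⟩) ⟩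
    affine-balance u = trans (⟨⟩-swap a u e) (trans (⟨⟩-congˡ u comb-a≋b) (sym (⟨⟩-swap b u e)))

    -- One of the two inequalities for an antipodal pair. Keeping it directed assigns every
    -- violation an end in the support of a and an end in the support of b.
    Separable : Fin n → Fin n → Set
    Separable p q = a p + b q < sum a

    -- U on the support of a and V on the support of b. Where both coefficients vanish the choice
    -- made by `disjoint` is harmless, since only the products with a k and b k enter the balance.
    twoLevels : Carrier → Carrier → Point n
    twoLevels U V k with disjoint k
    ... | inj₁ _ = V
    ... | inj₂ _ = U

    twoLevels-pos : ∀ {U V} → 0# < U → 0# < V → ∀ k → 0# < twoLevels U V k
    twoLevels-pos 0<U 0<V k with disjoint k
    ... | inj₁ _ = 0<V
    ... | inj₂ _ = 0<U

    a*twoLevels : ∀ U V k → a k * twoLevels U V k ≈ a k * U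
    a*twoLevels U V k with disjoint k
    ... | inj₁ a≈0 = trans (trans (*-congʳ a≈0) (zeroˡ V)) (sym (trans (*-congʳ a≈0) (zeroˡ U)))
    ... | inj₂ _   = refl

    b*twoLevels : ∀ U V k → b k * twoLevels U V k ≈ b k * V
    b*twoLevels U V k with disjoint k
    ... | inj₁ _   = refl
    ... | inj₂ b≈0 = trans (trans (*-congʳ b≈0) (zeroˡ U)) (sym (trans (*-congʳ b≈0) (zeroˡ V)))

    -- With value 0 at i, balance reads (T - a i) U = (T - b i) V; these levels solve it and are
    -- positive by the vertex condition.
    vertexLevels : Fin n → Point n
    vertexLevels i = zeroAt i (twoLevels (sum a - b i) (sum a - a i))

    private
      ⟨zeroAt⟩ : ∀ (f y : Point n) W i → (∀ k → f k * y k ≈ f k * W) →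
                 ⟨ f , zeroAt i y ⟩ ≈ sum f * W - f i * W
      ⟨zeroAt⟩ f y W i fy≈ = begin
        ⟨ f , zeroAt i y ⟩                 ≈⟨ ⟨⟩-updateAt f y i 0# ⟩
        ⟨ f , y ⟩ + f i * (0# - y i)       ≈⟨ solve 3 (λ s x y → s :+ x :* (con (0 , 0) :- y) := s :- x :* y) refl _ (f i) (y i) ⟩
        ⟨ f , y ⟩ - f i * y i              ≈⟨ +-cong (trans (sum-cong fy≈) (⟨⟩-constʳ f W)) (-‿cong (fy≈ i)) ⟩
        sum f * W - f i * W                ∎

    vertexLevels-balance : ∀ i → ⟨ (λ k → a k - b k) , vertexLevels i ⟩ ≈ 0#
    vertexLevels-balance i = begin
      ⟨ (λ k → a k - b k) , y ⟩        ≈⟨ ⟨⟩-minusˡ a b y ⟩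
      ⟨ a , y ⟩ - ⟨ b , y ⟩            ≈⟨ +-cong (⟨zeroAt⟩ a y° U i (a*twoLevels U V))
                                           (-‿cong (trans (⟨zeroAt⟩ b y° V i (b*twoLevels U V)) (+-congʳ (*-congʳ (sym sum-a≈b))))) ⟩
      (T * U - a i * U) - (T * V - b i * V)
        ≈⟨ solve 3 (λ t a b → (t :* (t :- b) :- a :* (t :- b)) :- (t :* (t :- a) :- b :* (t :- a)) := con (0 , 0)) refl T (a i) (b i) ⟩
      0#                               ∎
      where
      T = sum a
      U = T - b i
      V = T - a i
      y° = twoLevels U V
      y = vertexLevels i

    vertexLevels-pos : ∀ {i k} → k ≢ i → 0# < vertexLevels i k
    vertexLevels-pos {i} {k} k≢i = <-respʳ-≈ (sym (zeroAt-other _ k≢i))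
      (twoLevels-pos (x<y⇒0<y-x (b<sum-a i)) (x<y⇒0<y-x (a<sum i)) k)

    module _ {i j : Fin n} (i≢j : i ≢ j) where

      private
        T = sum a
        U = T - (a j + b i)
        V = T - (a i + b j)
        y° = twoLevels U V

      -- With value 0 at i and U + V at j, balance reduces to (T - (a i + b j)) U = (T - (a j + b
      -- i)) V. Taking U and V to be the two slacks solves it; if both are positive, they lie
      -- strictly between 0 and U + V.
      antipodalLevels : Point n
      antipodalLevels = updateAt (zeroAt i y°) j (const (U + V))

      antipodalLevels-balance : ⟨ (λ k → a k - b k) , antipodalLevels ⟩ ≈ 0#
      antipodalLevels-balance = begin
        ⟨ (λ k → a k - b k) , antipodalLevels ⟩              ≈⟨ ⟨⟩-minusˡ a b antipodalLevels ⟩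
        ⟨ a , antipodalLevels ⟩ - ⟨ b , antipodalLevels ⟩
          ≈⟨ +-cong (weigh a U (a*twoLevels U V)) (-‿cong (trans (weigh b V (b*twoLevels U V)) (+-congʳ (+-congʳ (*-congʳ (sym sum-a≈b)))))) ⟩
        (T * U - a i * U + (a j * (U + V) - a j * U)) - (T * V - b i * V + (b j * (U + V) - b j * V))
          ≈⟨ solve 5 (λ t ai aj bi bj → let U = t :- (aj :+ bi) ; V = t :- (ai :+ bj) in
               (t :* U :- ai :* U :+ (aj :* (U :+ V) :- aj :* U)) :- (t :* V :- bi :* V :+ (bj :* (U :+ V) :- bj :* V)) := con (0 , 0))
               refl T (a i) (a j) (b i) (b j) ⟩
        0# ∎
        where
        weigh : ∀ (f : Point n) W → (∀ k → f k * y° k ≈ f k * W) →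
                ⟨ f , antipodalLevels ⟩ ≈ sum f * W - f i * W + (f j * (U + V) - f j * W)
        weigh f W fy≈ = begin
          ⟨ f , antipodalLevels ⟩
            ≈⟨ ⟨⟩-updateAt f (zeroAt i y°) j (U + V) ⟩
          ⟨ f , zeroAt i y° ⟩ + f j * (U + V - zeroAt i y° j)
            ≈⟨ +-cong (⟨zeroAt⟩ f y° W i fy≈) (*-congˡ (+-congˡ (-‿cong (zeroAt-other y° (i≢j ∘ ≡.sym))))) ⟩
          sum f * W - f i * W + f j * (U + V - y° j)
            ≈⟨ +-congˡ (trans (solve 3 (λ f s y → f :* (s :- y) := f :* s :- f :* y) refl (f j) (U + V) (y° j))
                 (+-congˡ (-‿cong (fy≈ j)))) ⟩
          sum f * W - f i * W + (f j * (U + V) - f j * W) ∎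

      antipodalLevels-bottom : antipodalLevels i ≈ 0#
      antipodalLevels-bottom = trans (reflexive (updateAt-minimal i j _ i≢j)) (reflexive (updateAt-updates i y°))

      antipodalLevels-top : antipodalLevels j ≈ U + V
      antipodalLevels-top = reflexive (updateAt-updates j (zeroAt i y°))

      module _ (0<U : 0# < U) (0<V : 0# < V) where

        top-pos : 0# < U + V
        top-pos = pos+nonneg 0<U (inj₁ 0<V)

        antipodalLevels-lower : ∀ {k} → k ≢ i → 0# < antipodalLevels k
        antipodalLevels-lower {k} k≢i with k Fin.≟ j
        ... | yes ≡.refl = <-respʳ-≈ (sym antipodalLevels-top) top-pos
        ... | no k≢j     = <-respʳ-≈ (sym (trans (reflexive (updateAt-minimal k j _ k≢j)) (zeroAt-other y° k≢i)))
                             (twoLevels-pos 0<U 0<V k)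

        antipodalLevels-upper : ∀ {k} → k ≢ j → 0# < U + V - antipodalLevels k
        antipodalLevels-upper {k} k≢j with k Fin.≟ i
        ... | yes ≡.refl = <-respʳ-≈ (trans (solve 1 (λ s → s := s :- con (0 , 0)) refl (U + V)) (+-congˡ (-‿cong (sym antipodalLevels-bottom)))) top-pos
        ... | no k≢i     = <-respʳ-≈ (+-congˡ (-‿cong (sym (trans (reflexive (updateAt-minimal k j _ k≢j)) (zeroAt-other y° k≢i))))) below
          where
          below : 0# < U + V - y° k
          below with disjoint k
          ... | inj₁ _ = <-respʳ-≈ (solve 2 (λ u v → u := u :+ v :- v) refl U V) 0<U
          ... | inj₂ _ = <-respʳ-≈ (solve 2 (λ u v → v := u :+ v :- u) refl U V) 0<V

    -- Summing aₖ (yₖ - yᵢ) + bₖ (yⱼ - yₖ) over all k gives (yⱼ - yᵢ) Σ a.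
    extremal⇒separable : ∀ y → ⟨ a , y ⟩ ≈ ⟨ b , y ⟩ → ∀ {i j} → i ≢ j →
                         (∀ {k} → k ≢ i → y i < y k) → (∀ {k} → k ≢ j → y k < y j) → Separable j i
    extremal⇒separable y balance {i} {j} i≢j lower upper with (a j + b i) <? sum a
    ... | yes p = p
    -- Strictness needs a third index with a positive term. If T ≤ a j + b i, then b i < T gives a j
    -- > 0, so b j = 0 and the second index k with b k > 0 differs from j as well as from i.
    ... | no ¬p with b-another i
    ...   | k , k≢i , 0<bk = contradiction (*-cancel-pos 0<M (<-≤-trans 0<gk
              (≤-by (x≤y⇒0≤y-x (three≤sum g≥0 (i≢j ∘ ≡.sym) k≢i k≢j))
                (begin
                  sum g - (g i + (g j + g k))
                    ≈⟨ +-cong sum-g (-‿cong (+-cong gi≈ (+-congʳ gj≈))) ⟩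
                  T * M - (b i * M + (a j * M + g k))
                    ≈⟨ solve 5 (λ t m b a g → t :* m :- (b :* m :+ (a :* m :+ g)) := m :* (t :- (a :+ b)) :- g) refl T M (b i) (a j) (g k) ⟩
                  M * (T - (a j + b i)) - g k ∎))))
              (λ 0<slack → ¬p (0<y-x⇒x<y 0<slack))
      where
      T = sum a
      M = y j - y i
      0<M : 0# < M
      0<M = x<y⇒0<y-x (lower (i≢j ∘ ≡.sym))
      g : Point _
      g k = a k * (y k - y i) + b k * (y j - y k)
      ≥lower : ∀ k → 0# ≤ y k - y i
      ≥lower k with k Fin.≟ i
      ... | yes ≡.refl = inj₂ (sym (-‿inverseʳ (y i)))
      ... | no k≢i     = inj₁ (x<y⇒0<y-x (lower k≢i))
      ≤upper : ∀ k → 0# ≤ y j - y k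
      ≤upper k with k Fin.≟ j
      ... | yes ≡.refl = inj₂ (sym (-‿inverseʳ (y j)))
      ... | no k≢j     = inj₁ (x<y⇒0<y-x (upper k≢j))
      g≥0 : ∀ k → 0# ≤ g k
      g≥0 k = nonneg+nonneg (nonneg*nonneg (a≥0 k) (≥lower k)) (nonneg*nonneg (b≥0 k) (≤upper k))
      sum-g : sum g ≈ T * M
      sum-g = begin
        sum g
          ≈⟨ sum-+ (λ k → a k * (y k - y i)) (λ k → b k * (y j - y k)) ⟩
        ⟨ a , (λ k → y k - y i) ⟩ + ⟨ b , (λ k → y j - y k) ⟩
          ≈⟨ +-cong (⟨⟩-minusʳ a y (λ _ → y i)) (⟨⟩-minusʳ b (λ _ → y j) y) ⟩
        (⟨ a , y ⟩ - ⟨ a , (λ _ → y i) ⟩) + (⟨ b , (λ _ → y j) ⟩ - ⟨ b , y ⟩)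
          ≈⟨ +-cong (+-cong balance (-‿cong (⟨⟩-constʳ a (y i))))
               (+-congʳ (trans (⟨⟩-constʳ b (y j)) (*-congʳ (sym sum-a≈b)))) ⟩
        (⟨ b , y ⟩ - T * y i) + (T * y j - ⟨ b , y ⟩)
          ≈⟨ solve 4 (λ s t yi yj → (s :- t :* yi) :+ (t :* yj :- s) := t :* (yj :- yi)) refl _ T (y i) (y j) ⟩
        T * M ∎
      slack : T ≤ a j + b i
      slack = ≮⇒≥ ¬p
      0<aj : 0# < a j
      0<aj = <-by (x<y⇒0<y-x (<-≤-trans (b<sum-a i) slack)) (solve 2 (λ x y → x :+ y :- y := x :- con (0 , 0)) refl (a j) (b i))
      k≢j : k ≢ j
      k≢j ≡.refl = 0<x⇒x≉0 0<bk (0<a⇒b≈0 0<aj)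
      0<gk : 0# < g k
      0<gk = nonneg+pos (nonneg*nonneg (a≥0 k) (≥lower k)) (*-pos 0<bk (x<y⇒0<y-x (upper k≢j)))
      gi≈ : g i ≈ b i * M
      gi≈ = solve 4 (λ a b yi yj → a :* (yi :- yi) :+ b :* (yj :- yi) := b :* (yj :- yi)) refl (a i) (b i) (y i) (y j)
      gj≈ : g j ≈ a j * M
      gj≈ = solve 4 (λ a b yi yj → a :* (yj :- yi) :+ b :* (yj :- yj) := a :* (yj :- yi)) refl (a j) (b j) (y i) (y j)

  swap : {e : Vector (Point d) n} → Circuit e → Circuit e
  swap C = record
    { a = b ; b = a ; a≥0 = b≥0 ; b≥0 = a≥0 ; disjoint = Sum.swap ∘ disjoint
    ; sum-a≈b = sym sum-a≈b ; comb-a≋b = ≋-sym comb-a≋b ; a<sum = b<sum ; b<sum = a<sum }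
    where open Circuit C

  private
    parts : ∀ x → ∃[ a ] ∃[ b ] 0# ≤ a × 0# ≤ b × (a ≈ 0# ⊎ b ≈ 0#) × a - b ≈ x × (0# < x → 0# < a) × (0# < - x → 0# < b)
    parts x with compare x 0#
    ... | tri< x<0 _ ¬0<x = 0# , - x , ≤-refl , inj₁ (neg⇒0<- x<0) , inj₁ refl ,
                            solve 1 (λ x → con (0 , 0) :- (:- x) := x) refl x , (λ p → contradiction p ¬0<x) , λ p → p
    ... | tri≈ _ x≈0 ¬0<x = 0# , 0# , ≤-refl , ≤-refl , inj₁ refl , trans (-‿inverseʳ 0#) (sym x≈0) ,
                            (λ p → contradiction p ¬0<x) ,
                            λ p → contradiction (<-respʳ-≈ (trans (-‿cong x≈0) (solve 0 (:- con (0 , 0) := con (0 , 0)) refl)) p) (<-irrefl refl)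
    ... | tri> ¬x<0 _ 0<x = x , 0# , inj₁ 0<x , ≤-refl , inj₂ refl ,
                            solve 1 (λ x → x :- con (0 , 0) := x) refl x , (λ p → p) ,
                            λ p → contradiction (<-by p (solve 1 (λ x → :- x := con (0 , 0) :- x) refl x)) ¬x<0

  relation⇒Circuit : {e : Vector (Point d) n} {u : Point n} → IsRelation e u →
                     (∀ i → ∃[ k ] k ≢ i × 0# < u k) → (∀ i → ∃[ k ] k ≢ i × 0# < - u k) → Circuit e
  relation⇒Circuit {n = n} {e} {u} (Σu≈0 , ue≈0) others⁺ others⁻ = record
    { a = a ; b = b
    ; a≥0 = a≥0 ; b≥0 = b≥0
    ; disjoint = λ i → proj₁ (proj₂ (proj₂ (proj₂ (proj₂ (parts (u i))))))
    ; sum-a≈b = x-y≈0⇒x≈y (trans (sym (sum-minus a b)) (trans (sum-cong a-b≈u) Σu≈0))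
    ; comb-a≋b = λ c → x-y≈0⇒x≈y (trans (sym (⟨⟩-minusˡ a b (λ i → e i c))) (trans (⟨⟩-congʳ (λ i → e i c) a-b≈u) (ue≈0 c)))
    ; a<sum = λ i → another⇒term<sum a≥0 (let k , k≢i , p = others⁺ i in
        k , k≢i , proj₁ (proj₂ (proj₂ (proj₂ (proj₂ (proj₂ (proj₂ (parts (u k)))))))) p)
    ; b<sum = λ i → another⇒term<sum b≥0 (let k , k≢i , p = others⁻ i in
        k , k≢i , proj₂ (proj₂ (proj₂ (proj₂ (proj₂ (proj₂ (proj₂ (parts (u k)))))))) p)
    }
    where
    a b : Point n
    a k = proj₁ (parts (u k))
    b k = proj₁ (proj₂ (parts (u k)))
    a≥0 : ∀ i → 0# ≤ a i
    a≥0 i = proj₁ (proj₂ (proj₂ (parts (u i))))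
    b≥0 : ∀ i → 0# ≤ b i
    b≥0 i = proj₁ (proj₂ (proj₂ (proj₂ (parts (u i)))))
    a-b≈u : ∀ i → a i - b i ≈ u i
    a-b≈u i = proj₁ (proj₂ (proj₂ (proj₂ (proj₂ (proj₂ (parts (u i)))))))

-- Supporting hyperplanes, vertices and antipodal pairs in terms of the circuit.

module Faces (ℝ : RealNumbers) where

  open RealNumbers ℝ
  open OrderedField ℝ
  open Convex ℝ
  open LinearAlgebra ℝ
  open AffineGeometry ℝ
  open Circuits ℝ
  open import Relation.Binary.Reasoning.Setoid setoid

  private
    variable
      d n : ℕ

  -- The weights sum to 1, so the constant term passes through the combination.
  ⟨linComb⟩+shift : ∀ (w : Point n) (e : Vector (Point d) n) u s {y : Point n} → sum w ≈ 1# →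
                    (∀ k → ⟨ u , e k ⟩ + s ≈ y k) → ⟨ u , linComb w e ⟩ + s ≈ ⟨ w , y ⟩
  ⟨linComb⟩+shift w e u s {y} Σw≈1 value = begin
    ⟨ u , linComb w e ⟩ + s                       ≈⟨ +-cong (⟨⟩-swap w u e) (trans (*-congʳ Σw≈1) (*-identityˡ s)) ⟨
    ⟨ w , (λ k → ⟨ u , e k ⟩) ⟩ + sum w * s       ≈⟨ +-congˡ (⟨⟩-constʳ w s) ⟨
    ⟨ w , (λ k → ⟨ u , e k ⟩) ⟩ + ⟨ w , (λ _ → s) ⟩
      ≈⟨ sum-+ (λ k → w k * ⟨ u , e k ⟩) (λ k → w k * s) ⟨
    sum (λ k → w k * ⟨ u , e k ⟩ + w k * s)       ≈⟨ sum-cong (λ k → trans (solve 3 (λ w x s → w :* x :+ w :* s := w :* (x :+ s)) refl (w k) _ s) (*-congˡ (value k))) ⟩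
    ⟨ w , y ⟩                                     ∎

  -- Isolates what is used about P, so that convex hulls, iterated pyramids and capped simplices are
  -- treated alike.
  record Between (e : Vector (Point d) n) (P : Subset d) : Set where
    field
      range⊆ : range e ⊆ P
      ⊆hull  : P ⊆ ConvexHull e

  Between-conv : {e : Vector (Point d) n} {X : Subset d} → X ≐ range e → Between e (conv X)
  Between-conv (X⊆ , ⊆X) = record
    { range⊆ = S⊆conv ∘ ⊆X
    ; ⊆hull  = conv⊆ConvexHull (range⊆ConvexHull ∘ X⊆)
    }

  module _ {e : Vector (Point d) n} {P : Subset d} (between : Between e P) where

    open Between between

    -- Write v as a convex combination of e. The values of e relative to H have one sign and average
    -- to 0, so an e k of positive weight lies on H, where v is the only point of P.
    vert⊆range : vert P ⊆ range e
    vert⊆range {v} (H , (_ , side) , P∩H⊆v , v⊆P∩H) with ⊆hull (proj₁ (v⊆P∩H ≋-refl))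
    ... | w , w≥0 , Σw≈1 , v≋ with pos-sum⇒pos-term w≥0 (<-respʳ-≈ (sym Σw≈1) 0<1)
    ...   | k , 0<wk = k , ≋-sym (P∩H⊆v (range⊆ (k , ≋-refl) , onH side))
      where
      h = offset H
      z : Point n
      z i = ⟨ normal H , e i ⟩ - h
      wz≈0 : ⟨ w , z ⟩ ≈ 0#
      wz≈0 = trans (sym (⟨linComb⟩+shift w e (normal H) (- h) Σw≈1 (λ _ → refl)))
        (trans (+-congʳ (trans (⟨⟩-congˡ (normal H) (≋-sym v≋)) (proj₂ (v⊆P∩H ≋-refl)))) (-‿inverseʳ h))
      onH : _ → ⟨ normal H , e k ⟩ ≈ h
      onH (inj₂ above) = x-y≈0⇒x≈y (*-cancel-0 (0<x⇒x≉0 0<wk)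
        (sum≈0⇒term≈0 (λ i → nonneg*nonneg (w≥0 i) (x≤y⇒0≤y-x (above (e i) (range⊆ (i , ≋-refl))))) wz≈0 k))
      onH (inj₁ below) = sym (x-y≈0⇒x≈y (*-cancel-0 (0<x⇒x≉0 0<wk)
        (sum≈0⇒term≈0 {f = λ i → w i * (h - ⟨ normal H , e i ⟩)}
          (λ i → nonneg*nonneg (w≥0 i) (x≤y⇒0≤y-x (below (e i) (range⊆ (i , ≋-refl)))))
          (begin
            ⟨ w , (λ i → h - ⟨ normal H , e i ⟩) ⟩  ≈⟨ sum-cong (λ i → solve 3 (λ w h x → w :* (h :- x) := (:- con (1 , 0)) :* (w :* (x :- h))) refl (w i) h _) ⟩
            sum (λ i → (- 1#) * (w i * z i))       ≈⟨ sum-*ˡ (- 1#) (λ i → w i * z i) ⟩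
            (- 1#) * ⟨ w , z ⟩                     ≈⟨ trans (*-congˡ wz≈0) (zeroʳ _) ⟩
            0#                                     ∎)
          k)))

    module _ {u : Point d} {s : Carrier} {y : Point n} (value : ∀ k → ⟨ u , e k ⟩ + s ≈ y k)
             {i : Fin n} (yi≈0 : y i ≈ 0#) (0<y : ∀ {k} → k ≢ i → 0# < y k)
             (other : ∃[ k ] k ≢ i) where

      private
        -- A zero normal would make the function constant, but it vanishes at i and is positive at a
        -- second index.
        u≉0 : ¬ u ≋ replicate d 0#
        u≉0 u≋0 = 0<x⇒x≉0 (0<y (proj₂ other)) (begin
          y k   ≈⟨ value≈s k ⟩
          s     ≈⟨ value≈s i ⟨
          y i   ≈⟨ yi≈0 ⟩
          0#    ∎)
          where
          k = proj₁ other
          value≈s : ∀ k → y k ≈ s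
          value≈s k = trans (sym (value k)) (trans (+-congʳ (sum-0 (λ c → trans (*-congʳ (u≋0 c)) (zeroˡ _)))) (+-identityˡ s))

        y≥0 : ∀ k → 0# ≤ y k
        y≥0 k with k Fin.≟ i
        ... | yes ≡.refl = inj₂ (sym yi≈0)
        ... | no k≢i     = inj₁ (0<y k≢i)

      faceHyperplane : Hyperplane d
      faceHyperplane = record { normal = u ; offset = - s ; normal≉0 = u≉0 }

      e∈face : {p : Point d} → p ≋ e i → p ∈ ⟦ faceHyperplane ⟧
      e∈face {p} p≋ = begin
        ⟨ u , p ⟩              ≈⟨ ⟨⟩-congˡ u p≋ ⟩
        ⟨ u , e i ⟩            ≈⟨ solve 2 (λ x s → x := x :+ s :- s) refl _ s ⟩
        ⟨ u , e i ⟩ + s - s    ≈⟨ +-congʳ (trans (value i) yi≈0) ⟩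
        0# - s                 ≈⟨ +-identityˡ (- s) ⟩
        - s                    ∎

      face-supports : Supports faceHyperplane P
      face-supports = (e i , range⊆ (i , ≋-refl) , e∈face ≋-refl) , inj₂ above
        where
        above : ∀ p → p ∈ P → - s ≤ ⟨ u , p ⟩
        above p p∈P with ⊆hull p∈P
        ... | w , w≥0 , Σw≈1 , p≋ = ≤-by (sum-nonneg (λ k → nonneg*nonneg (w≥0 k) (y≥0 k)))
          (trans (sym (⟨linComb⟩+shift w e u s Σw≈1 value))
            (trans (+-congʳ (⟨⟩-congˡ u (≋-sym p≋))) (solve 2 (λ x s → x :+ s := x :- (:- s)) refl _ s)))

      -- For a point of P on the hyperplane the weighted average of y is 0; since y is positive off
      -- i, all weight sits at i.
      face≐ : {p : Point d} → p ≋ e i → (P ∩ ⟦ faceHyperplane ⟧) ≐ ｛ p ｝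
      face≐ {p} p≋ = to , λ q≋p → range⊆ (i , ≋-trans q≋p p≋) , e∈face (≋-trans q≋p p≋)
        where
        to : (P ∩ ⟦ faceHyperplane ⟧) ⊆ ｛ p ｝
        to {q} (q∈P , q∈H) with ⊆hull q∈P
        ... | w , w≥0 , Σw≈1 , q≋ = λ c → begin
          q c                            ≈⟨ q≋ c ⟩
          linComb w e c                  ≈⟨ sum-cong (λ k → concentrated k c) ⟩
          ⟨ w , (λ _ → e i c) ⟩          ≈⟨ ⟨⟩-constʳ w (e i c) ⟩
          sum w * e i c                  ≈⟨ trans (*-congʳ Σw≈1) (*-identityˡ _) ⟩
          e i c                          ≈⟨ p≋ c ⟨
          p c                            ∎
          where
          wy≈0 : ⟨ w , y ⟩ ≈ 0#
          wy≈0 = trans (sym (⟨linComb⟩+shift w e u s Σw≈1 value))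
            (trans (+-congʳ (trans (⟨⟩-congˡ u (≋-sym q≋)) q∈H)) (solve 1 (λ s → :- s :+ s := con (0 , 0)) refl s))
          concentrated : ∀ k c → w k * e k c ≈ w k * e i c
          concentrated k c with k Fin.≟ i
          ... | yes ≡.refl = refl
          ... | no k≢i     = trans (*-congʳ wk≈0) (trans (zeroˡ _) (sym (trans (*-congʳ wk≈0) (zeroˡ _))))
            where
            wk≈0 : w k ≈ 0#
            wk≈0 = *-cancel-0 (0<x⇒x≉0 (0<y k≢i)) (trans (*-comm _ _)
              (sum≈0⇒term≈0 (λ k → nonneg*nonneg (w≥0 k) (y≥0 k)) wy≈0 k))

    -- P may lie on either side of H; the sign σ, which is 1 or - 1, lets later arguments treat both
    -- sides at once. The inequality is strict because X meets H in p alone and e is injective.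
    exposing : {X : Subset d} → range e ⊆ X → Injective _≡_ _≋_ e →
               ∀ {i p} (H : Hyperplane d) → p ≋ e i → Supports H P → (X ∩ ⟦ H ⟧) ≐ ｛ p ｝ →
               ∃[ σ ] σ * σ ≈ 1# × (∀ {k} → k ≢ i → 0# < σ * (⟨ normal H , e k ⟩ - ⟨ normal H , e i ⟩))
    exposing {X} ⊆X inj {i} {p} H p≋ (_ , side) (X∩H⊆ , ⊆X∩H) with side
    ... | inj₂ above = 1# , *-identityˡ 1# , λ {k} k≢i →
          <-respʳ-≈ (trans (+-congˡ (-‿cong (sym ei∈H))) (sym (*-identityˡ _))) (strict k≢i (above (e k) (range⊆ (k , ≋-refl))))
      where
      ei∈H : ⟨ normal H , e i ⟩ ≈ offset H
      ei∈H = proj₂ (⊆X∩H (≋-sym p≋))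
      strict : ∀ {k} → k ≢ i → offset H ≤ ⟨ normal H , e k ⟩ → 0# < ⟨ normal H , e k ⟩ - offset H
      strict k≢i (inj₁ p) = x<y⇒0<y-x p
      strict {k} k≢i (inj₂ eq) = contradiction (inj (≋-trans (X∩H⊆ (⊆X (k , ≋-refl) , sym eq)) p≋)) k≢i
    ... | inj₁ below = - 1# , solve 0 ((:- con (1 , 0)) :* (:- con (1 , 0)) := con (1 , 0)) refl , λ {k} k≢i →
          <-respʳ-≈ (trans (+-congʳ (sym ei∈H)) (solve 2 (λ x y → x :- y := (:- con (1 , 0)) :* (y :- x)) refl _ _))
            (strict k≢i (below (e k) (range⊆ (k , ≋-refl))))
      where
      ei∈H : ⟨ normal H , e i ⟩ ≈ offset H
      ei∈H = proj₂ (⊆X∩H (≋-sym p≋))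
      strict : ∀ {k} → k ≢ i → ⟨ normal H , e k ⟩ ≤ offset H → 0# < offset H - ⟨ normal H , e k ⟩
      strict k≢i (inj₁ p) = x<y⇒0<y-x p
      strict {k} k≢i (inj₂ eq) = contradiction (inj (≋-trans (X∩H⊆ (⊆X (k , ≋-refl) , eq)) p≋)) k≢i

  module _ {e : Vector (Point d) (suc (suc d))} (frame : Coordinates e) (C : Circuit e) where

    open Circuit C

    private
      realise′ : ∀ y → ⟨ (λ k → a k - b k) , y ⟩ ≈ 0# → ∃[ u ] ∃[ s ] ∀ k → ⟨ u , e k ⟩ + s ≈ y k
      realise′ = realise frame {λ k → a k - b k} relation (proj₂ (nontrivial zero))

      another-index : ∀ i → ∃[ k ] k ≢ i
      another-index i = proj₁ (a-another i) , proj₁ (proj₂ (a-another i))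

    -- The levels for i come from an affine function that is 0 at e i and positive at every other e
    -- k, so it distinguishes the points.
    circuit⇒injective : Injective _≡_ _≋_ e
    circuit⇒injective {i} {k} ei≋ek with k Fin.≟ i
    ... | yes k≡i = ≡.sym k≡i
    ... | no k≢i = let u , s , value = realise′ (vertexLevels i) (vertexLevels-balance i) in contradiction
      (trans (sym (value k)) (trans (+-congʳ (⟨⟩-congˡ u (≋-sym ei≋ek)))
        (trans (value i) (reflexive (updateAt-updates i (twoLevels (sum a - b i) (sum a - a i)))))))
      (0<x⇒x≉0 (vertexLevels-pos k≢i))

    vert≐range : {P : Subset d} → Between e P → vert P ≐ range e
    vert≐range {P} between = vert⊆range between , λ {v} → to {v}
      where
      to : range e ⊆ vert P
      to {v} (i , v≋) = faceHyperplane between value zero-at vertexLevels-pos (another-index i) ,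
                            face-supports between value zero-at vertexLevels-pos (another-index i) ,
                            face≐ between value zero-at vertexLevels-pos (another-index i) v≋
        where
        value = proj₂ (proj₂ (realise′ (vertexLevels i) (vertexLevels-balance i)))
        zero-at : vertexLevels i i ≈ 0#
        zero-at = reflexive (updateAt-updates i (twoLevels (sum a - b i) (sum a - a i)))

    module _ {X : Subset d} (X≐ : X ≐ range e) where

      private
        between : Between e (conv X)
        between = Between-conv X≐

        restrict : ∀ {H p} → p ∈ X → (conv X ∩ ⟦ H ⟧) ≐ ｛ p ｝ → (X ∩ ⟦ H ⟧) ≐ ｛ p ｝
        restrict {H} {p} p∈X (to , from) =
          (λ (q∈X , q∈H) → to (S⊆conv q∈X , q∈H)) ,
          λ q≋p → proj₂ X≐ (let k , p≋ = proj₁ X≐ p∈X in k , ≋-trans q≋p p≋) , proj₂ (from q≋p)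

      -- Both hyperplanes are zero sets of nonnegative functions: H′ of the one with values y, which
      -- vanishes only at i, and H″ of its complement h - y, which vanishes only at j. Their normals
      -- are opposite.
      separable⇒antipodal : ∀ {i j p q} → i ≢ j → Separable j i → Separable i j →
                            p ≋ e i → q ≋ e j → StrictlyAntipodal X p q
      separable⇒antipodal {i} {j} {p} {q} i≢j ji ij p≋ q≋ =
        p∈X , q∈X , (λ p≋q → i≢j (circuit⇒injective (≋-trans (≋-sym p≋) (≋-trans p≋q q≋)))) ,
        H′ , H″ ,
        face-supports between value bottom lower (another-index i) ,
        face-supports between value″ top upper (another-index j) ,
        (- 1# , λ c → solve 1 (λ x → :- x := (:- con (1 , 0)) :* x) refl (u c)) ,
        (λ (H′⊆H″ , _) → 0<x⇒x≉0 (upper i≢j) (trans (sym (value″ i))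
          (trans (+-congʳ (H′⊆H″ (e∈face between value bottom lower (another-index i) ≋-refl))) (solve 1 (λ s → :- s :+ s := con (0 , 0)) refl s″)))) ,
        restrict {H = H′} p∈X (face≐ between value bottom lower (another-index i) p≋) ,
        restrict {H = H″} q∈X (face≐ between value″ top upper (another-index j) q≋)
        where
        y = antipodalLevels i≢j
        u = proj₁ (realise′ y (antipodalLevels-balance i≢j))
        s = proj₁ (proj₂ (realise′ y (antipodalLevels-balance i≢j)))
        value : ∀ k → ⟨ u , e k ⟩ + s ≈ y k
        value = proj₂ (proj₂ (realise′ y (antipodalLevels-balance i≢j)))
        -- The top level U + V, attained at j only.
        h = (sum a - (a j + b i)) + (sum a - (a i + b j))
        s″ = h - s
        p∈X = proj₂ X≐ (i , p≋)
        q∈X = proj₂ X≐ (j , q≋)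
        bottom = antipodalLevels-bottom i≢j
        lower : ∀ {k} → k ≢ i → 0# < y k
        lower = antipodalLevels-lower i≢j (x<y⇒0<y-x ji) (x<y⇒0<y-x ij)
        upper : ∀ {k} → k ≢ j → 0# < h - y k
        upper = antipodalLevels-upper i≢j (x<y⇒0<y-x ji) (x<y⇒0<y-x ij)
        top : h - y j ≈ 0#
        top = trans (+-congˡ (-‿cong (antipodalLevels-top i≢j))) (-‿inverseʳ h)
        value″ : ∀ k → ⟨ (λ c → - u c) , e k ⟩ + s″ ≈ h - y k
        value″ k = begin
          ⟨ (λ c → - u c) , e k ⟩ + s″
            ≈⟨ +-congʳ (trans (⟨⟩-congʳ (e k) (λ c → solve 1 (λ x → :- x := (:- con (1 , 0)) :* x) refl (u c))) (⟨⟩-*ˡ (- 1#) u (e k))) ⟩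
          (- 1#) * ⟨ u , e k ⟩ + (h - s)
            ≈⟨ solve 3 (λ x h s → (:- con (1 , 0)) :* x :+ (h :- s) := h :- (x :+ s)) refl _ h s ⟩
          h - (⟨ u , e k ⟩ + s)          ≈⟨ +-congˡ (-‿cong (value k)) ⟩
          h - y k                        ∎
        H′ = faceHyperplane between value bottom lower (another-index i)
        H″ = faceHyperplane between value″ top upper (another-index j)

      -- Orienting the normal of H′ by σ makes i the strict minimum. Being parallel, H″ exposes j as
      -- a strict minimum or maximum of the same functional, and a minimum is excluded because i
      -- lies lower.
      antipodal⇒extremal : ∀ {i j p q} → StrictlyAntipodal X p q → p ≋ e i → q ≋ e j →
        i ≢ j × ∃[ u ] (∀ {k} → k ≢ i → ⟨ u , e i ⟩ < ⟨ u , e k ⟩) × (∀ {k} → k ≢ j → ⟨ u , e k ⟩ < ⟨ u , e j ⟩)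
      antipodal⇒extremal {i} {j} (_ , _ , p≉q , H′ , H″ , sup′ , sup″ , (t , n″≋) , _ , face′ , face″) p≋ q≋ =
        i≢j , u , (λ {k} k≢i → 0<y-x⇒x<y (<-respʳ-≈ (u-diff i k) (low k≢i))) , upper
        where
        exposing′ = exposing between (proj₂ X≐) circuit⇒injective H′ p≋ sup′ face′
        exposing″ = exposing between (proj₂ X≐) circuit⇒injective H″ q≋ sup″ face″
        σ = proj₁ exposing′
        σσ≈1 = proj₁ (proj₂ exposing′)
        τ = proj₁ exposing″
        low : ∀ {k} → k ≢ i → 0# < σ * (⟨ normal H′ , e k ⟩ - ⟨ normal H′ , e i ⟩)
        low = proj₂ (proj₂ exposing′)
        high : ∀ {k} → k ≢ j → 0# < τ * (⟨ normal H″ , e k ⟩ - ⟨ normal H″ , e j ⟩)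
        high = proj₂ (proj₂ exposing″)
        u : Point _
        u c = σ * normal H′ c
        x : Fin _ → Carrier
        x k = ⟨ normal H′ , e k ⟩
        i≢j : i ≢ j
        i≢j ≡.refl = p≉q (≋-trans p≋ (≋-sym q≋))
        u≈ : ∀ k → ⟨ u , e k ⟩ ≈ σ * x k
        u≈ k = ⟨⟩-*ˡ σ (normal H′) (e k)
        u-diff : ∀ l k → σ * (x k - x l) ≈ ⟨ u , e k ⟩ - ⟨ u , e l ⟩
        u-diff l k = trans (solve 3 (λ σ x y → σ :* (x :- y) := σ :* x :- σ :* y) refl σ (x k) (x l))
          (+-cong (sym (u≈ k)) (-‿cong (sym (u≈ l))))
        -- The factor relating the oriented normal of H″ to u. Its sign is unknown at first;
        -- comparing i with j, where u is already known to increase, shows that it is positive.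
        r : Carrier
        r = - (τ * t * σ)
        scaled : ∀ {k} → k ≢ j → 0# < r * (σ * (x j - x k))
        scaled {k} k≢j = <-respʳ-≈ (begin
          τ * (⟨ normal H″ , e k ⟩ - ⟨ normal H″ , e j ⟩)  ≈⟨ *-congˡ (+-cong (n″≈ k) (-‿cong (n″≈ j))) ⟩
          τ * (t * x k - t * x j)
            ≈⟨ solve 4 (λ τ t x y → τ :* (t :* x :- t :* y) := con (1 , 0) :* (τ :* t :* (x :- y))) refl τ t (x k) (x j) ⟩
          1# * (τ * t * (x k - x j))      ≈⟨ *-congʳ σσ≈1 ⟨
          σ * σ * (τ * t * (x k - x j))
            ≈⟨ solve 5 (λ σ τ t x y → σ :* σ :* (τ :* t :* (x :- y)) := :- (τ :* t :* σ) :* (σ :* (y :- x))) refl σ τ t (x k) (x j) ⟩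
          r * (σ * (x j - x k))           ∎) (high k≢j)
          where
          n″≈ : ∀ k → ⟨ normal H″ , e k ⟩ ≈ t * x k
          n″≈ k = trans (⟨⟩-congʳ (e k) n″≋) (⟨⟩-*ˡ t (normal H′) (e k))
        0<r : 0# < r
        0<r = *-cancel-pos (low (i≢j ∘ ≡.sym)) (<-respʳ-≈ (*-comm _ _) (scaled i≢j))
        upper : ∀ {k} → k ≢ j → ⟨ u , e k ⟩ < ⟨ u , e j ⟩
        upper {k} k≢j = 0<y-x⇒x<y (<-respʳ-≈ (u-diff k j) (*-cancel-pos 0<r (scaled k≢j)))

      -- One functional yields both inequalities: the second follows from the same argument with a
      -- and b exchanged.
      antipodal⇒separable : ∀ {i j p q} → StrictlyAntipodal X p q → p ≋ e i → q ≋ e j →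
                            i ≢ j × Separable j i × Separable i j
      antipodal⇒separable {i} {j} sa p≋ q≋ =
        let i≢j , u , low , high = antipodal⇒extremal sa p≋ q≋
            y = λ k → ⟨ u , e k ⟩
        in i≢j , extremal⇒separable y (affine-balance u) i≢j low high ,
        <-respˡ-≈ (+-comm _ _) (<-respʳ-≈ (sym sum-a≈b)
          (Circuit.extremal⇒separable (swap C) y (sym (affine-balance u)) i≢j low high))
  -- A functional exposing the vertex eᵢ has values of one sign on all eₖ - eᵢ, k ≠ i, and a relation
  -- pairs with these values to 0, so its other coefficients cannot all be ≤ 0.
  module _ {e : Vector (Point d) n} {X : Subset d} (X≐ : X ≐ range e) (inj : Injective _≡_ _≋_ e)
           (vertices : X ⊆ vert (conv X)) where

    vertex⇒pos-coefficient : ∀ {l} → IsRelation e l → ∀ {r} → ¬ l r ≈ 0# → ∀ i → ∃[ k ] k ≢ i × 0# < l k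
    vertex⇒pos-coefficient {l} (Σl≈0 , le≈0) {r} lr≉0 i with any? (λ k → ¬? (k Fin.≟ i) ×-dec (0# <? l k))
    ... | yes p = p
    ... | no ¬p with vertices (proj₂ X≐ (i , ≋-refl))
    ...   | H , sup , face = contradiction (l≈0 r) lr≉0
      where
      exposing′ = exposing (Between-conv X≐) (S⊆conv ∘ proj₂ X≐) inj H ≋-refl sup face
      σ = proj₁ exposing′
      exposed : ∀ {k} → k ≢ i → 0# < σ * (⟨ normal H , e k ⟩ - ⟨ normal H , e i ⟩)
      exposed = proj₂ (proj₂ exposing′)
      x : Fin n → Carrier
      x k = ⟨ normal H , e k ⟩
      z : Point n
      z k = σ * (x k - x i)
      lz≈0 : ⟨ l , z ⟩ ≈ 0#
      lz≈0 = begin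
        ⟨ l , z ⟩                              ≈⟨ sum-cong (λ k → solve 3 (λ l σ y → l :* (σ :* y) := σ :* (l :* y)) refl (l k) σ _) ⟩
        sum (λ k → σ * (l k * (x k - x i)))    ≈⟨ sum-*ˡ σ (λ k → l k * (x k - x i)) ⟩
        σ * ⟨ l , (λ k → x k - x i) ⟩          ≈⟨ *-congˡ (trans (⟨⟩-minusʳ l x (λ _ → x i)) (+-cong lx≈0 (-‿cong (trans (⟨⟩-constʳ l (x i)) (*-congʳ Σl≈0))))) ⟩
        σ * (0# - 0# * x i)                    ≈⟨ solve 2 (λ σ x → σ :* (con (0 , 0) :- con (0 , 0) :* x) := con (0 , 0)) refl σ (x i) ⟩
        0#                                     ∎
        where
        lx≈0 : ⟨ l , x ⟩ ≈ 0#
        lx≈0 = trans (⟨⟩-swap l (normal H) e) (trans (⟨⟩-congˡ (normal H) le≈0) (trans (⟨⟩-constʳ (normal H) 0#) (zeroʳ _)))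
      -- With no positive coefficient off i, all these terms are nonnegative; they sum to 0, so each
      -- vanishes.
      terms≥0 : ∀ k → 0# ≤ (- 1#) * (l k * z k)
      terms≥0 k with k Fin.≟ i
      ... | yes ≡.refl = inj₂ (solve 3 (λ l σ x → con (0 , 0) := (:- con (1 , 0)) :* (l :* (σ :* (x :- x)))) refl (l i) σ (x i))
      ... | no k≢i     = ≤-respʳ-≈ (solve 2 (λ l z → (con (0 , 0) :- l) :* z := (:- con (1 , 0)) :* (l :* z)) refl (l k) (z k))
                           (nonneg*nonneg (x≤y⇒0≤y-x (≮⇒≥ (λ 0<l → ¬p (k , k≢i , 0<l)))) (inj₁ (exposed k≢i)))
      l≈0-other : ∀ {k} → k ≢ i → l k ≈ 0#
      l≈0-other {k} k≢i = *-cancel-0 (0<x⇒x≉0 (exposed k≢i)) (begin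
        z k * l k                        ≈⟨ solve 2 (λ z l → z :* l := (:- con (1 , 0)) :* ((:- con (1 , 0)) :* (l :* z))) refl (z k) (l k) ⟩
        (- 1#) * ((- 1#) * (l k * z k))  ≈⟨ *-congˡ (sum≈0⇒term≈0 terms≥0 (trans (sum-*ˡ (- 1#) (λ k → l k * z k)) (trans (*-congˡ lz≈0) (zeroʳ _))) k) ⟩
        (- 1#) * 0#                      ≈⟨ zeroʳ _ ⟩
        0#                               ∎)
      -- The index i gives no information through z, which vanishes there; its coefficient is
      -- recovered from Σ l = 0.
      l≈0 : ∀ k → l k ≈ 0#
      l≈0 k with k Fin.≟ i
      ... | no k≢i     = l≈0-other k≢i
      ... | yes ≡.refl = begin
        l i                          ≈⟨ +-identityʳ _ ⟨
        l i + 0#                     ≈⟨ +-congˡ (sum-0 zeroed) ⟨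
        l i + sum (zeroAt i l)       ≈⟨ sum-zeroAt l i ⟨
        sum l                        ≈⟨ Σl≈0 ⟩
        0#                           ∎
        where
        zeroed : ∀ k → zeroAt i l k ≈ 0#
        zeroed k with k Fin.≟ i
        ... | yes ≡.refl = reflexive (updateAt-updates i l)
        ... | no k≢i     = trans (zeroAt-other l k≢i) (l≈0-other k≢i)

  -- The positivity statement is applied to a nontrivial relation and to its negative, which yields
  -- two coefficients of either sign.
  vertices⇒Circuit : {e : Vector (Point d) (suc (suc d))} {X : Subset d} → X ≐ range e →
                     Injective _≡_ _≋_ e → X ⊆ vert (conv X) → Circuit e
  vertices⇒Circuit {e = e} X≐ inj vertices =
    let l , (r , lr≉0) , rel@(Σl≈0 , le≈0) = nontrivialRelation e in
    relation⇒Circuit {u = l} rel (vertex⇒pos-coefficient X≐ inj vertices {l} rel {r} lr≉0)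
      (vertex⇒pos-coefficient X≐ inj vertices {λ k → - l k}
        ( trans (sum-cong (λ k → -≈ (l k))) (trans (sum-*ˡ (- 1#) l) (trans (*-congˡ Σl≈0) (zeroʳ _)))
        , λ c → trans (⟨⟩-congʳ (λ k → e k c) {λ k → - l k} {λ k → (- 1#) * l k} (λ k → -≈ (l k)))
                  (trans (⟨⟩-*ˡ (- 1#) l (λ k → e k c)) (trans (*-congˡ (le≈0 c)) (zeroʳ _))))
        {r} (λ -lr≈0 → lr≉0 (trans (solve 1 (λ x → x := (:- con (1 , 0)) :* (:- x)) refl (l r))
          (trans (*-congˡ -lr≈0) (zeroʳ _)))))
    where
    -≈ : ∀ x → - x ≈ (- 1#) * x
    -≈ = solve 1 (λ x → :- x := (:- con (1 , 0)) :* x) refl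

-- Counting unordered pairs among six indices.

module Pairs where

  pairs : (n : ℕ) → List (Fin n × Fin n)
  pairs n = filter (λ (i , j) → i Fin.<? j) (cartesianProduct (allFin n) (allFin n))

  ∈-pairs⁺ : ∀ {n} {i j : Fin n} → i Fin.< j → (i , j) ∈ₗ pairs n
  ∈-pairs⁺ i<j = ∈-filter⁺ _ (∈-cartesianProduct⁺ (∈-allFin _) (∈-allFin _)) i<j

  ∈-pairs⁻ : ∀ {n} {i j : Fin n} → (i , j) ∈ₗ pairs n → i Fin.< j
  ∈-pairs⁻ ij∈ = proj₂ (∈-filter⁻ _ {xs = cartesianProduct (allFin _) (allFin _)} ij∈)

  pairs-unique : ∀ n → Unique (pairs n)
  pairs-unique n = Unique.filter⁺ _ (Unique.cartesianProduct⁺ (Unique.allFin⁺ n) (Unique.allFin⁺ n))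

  lookup-injective : ∀ {A : Set} {xs : List A} → Unique xs → ∀ {i j} → lookup xs i ≡ lookup xs j → i ≡ j
  lookup-injective (_    ∷ₚ _) {zero}  {zero}  _  = ≡.refl
  lookup-injective (x∉xs ∷ₚ _) {zero}  {suc j} eq = contradiction eq (All.lookup x∉xs (∈-lookup j))
  lookup-injective (x∉xs ∷ₚ _) {suc i} {zero}  eq = contradiction (≡.sym eq) (All.lookup x∉xs (∈-lookup i))
  lookup-injective (_    ∷ₚ u) {suc i} {suc j} eq = ≡.cong suc (lookup-injective u eq)

  length-filter-mono : ∀ {A : Set} {P Q : Pred A 0ℓ} (P? : Decidable₁ P) (Q? : Decidable₁ Q) →
                       (∀ {x} → P x → Q x) → (xs : List A) → length (filter P? xs) ℕ.≤ length (filter Q? xs)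
  length-filter-mono P? Q? P⇒Q xs =
    Sublist.length-mono-≤ (Sublist.filter⁺ P? Q? (λ { ≡.refl → P⇒Q }) (Sublist.⊆-refl {x = xs}))

  private
    variable
      n : ℕ

  -- All edges at the centre m except the one to j; with n = 6 and m ≠ j there are four.
  Star : (m j p q : Fin n) → Set
  Star m j p q = (p ≡ m × q ≢ m × q ≢ j) ⊎ (q ≡ m × p ≢ m × p ≢ j)

  -- The four-cycle joining {i , i′} to {j , j′}, closed under exchanging p and q.
  Square : (i i′ j j′ p q : Fin n) → Set
  Square i i′ j j′ p q = ((p ≡ i ⊎ p ≡ i′) × (q ≡ j ⊎ q ≡ j′)) ⊎ ((q ≡ i ⊎ q ≡ i′) × (p ≡ j ⊎ p ≡ j′))

  star? : (m j : Fin n) → Decidable (Star m j)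
  star? m j p q = (p Fin.≟ m ×-dec ¬? (q Fin.≟ m) ×-dec ¬? (q Fin.≟ j)) ⊎-dec
                  (q Fin.≟ m ×-dec ¬? (p Fin.≟ m) ×-dec ¬? (p Fin.≟ j))

  square? : (i i′ j j′ : Fin n) → Decidable (Square i i′ j j′)
  square? i i′ j j′ p q =
    ((p Fin.≟ i ⊎-dec p Fin.≟ i′) ×-dec (q Fin.≟ j ⊎-dec q Fin.≟ j′)) ⊎-dec
    ((q Fin.≟ i ⊎-dec q Fin.≟ i′) ×-dec (p Fin.≟ j ⊎-dec p Fin.≟ j′))

  outside : {R : Fin 6 → Fin 6 → Set} → Decidable R → ℕ
  outside R? = length (filter (λ (p , q) → ¬? (R? p q)) (pairs 6))

  -- Checked by evaluation for all choices: 15 - 4 = 11. If m = j, nothing is left out, the star has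
  -- five edges and the bound fails.
  outside-star : ∀ m j → m ≡ j ⊎ 11 ℕ.≤ outside (star? m j)
  outside-star = from-yes (all? λ m → all? λ j → m Fin.≟ j ⊎-dec 11 ℕ.≤? outside (star? m j))

  -- Again by evaluation; coincidences among the four indices only lower the number of pairs
  -- removed.
  outside-square : ∀ i i′ j j′ → 11 ℕ.≤ outside (square? i i′ j j′)
  outside-square = from-yes (all? λ i → all? λ i′ → all? λ j → all? λ j′ → 11 ℕ.≤? outside (square? i i′ j j′))

-- The graph of violating pairs and the resulting value of sa.

module Antipodality (ℝ : RealNumbers) where

  open RealNumbers ℝ
  open OrderedField ℝ
  open Convex ℝ
  open LinearAlgebra ℝ
  open AffineGeometry ℝ
  open Circuits ℝ
  open Faces ℝ
  open Pairs
  open import Relation.Binary.Reasoning.Setoid setoid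

  private
    variable
      d n : ℕ

  module _ {e : Vector (Point d) n} (C : Circuit e) where

    open Circuit C

    separable? : Decidable Separable
    separable? p q = (a p + b q) <? sum a

    -- Since b q alone stays below T, reaching T takes a positive share from a p.
    inseparable⇒0<a : ∀ {p q} → ¬ Separable p q → 0# < a p
    inseparable⇒0<a {p} {q} ¬sep = <-by (x<y⇒0<y-x (<-≤-trans (b<sum-a q) (≮⇒≥ ¬sep)))
      (solve 2 (λ x y → x :+ y :- y := x :- con (0 , 0)) refl (a p) (b q))

    inseparable⇒0<b : ∀ {p q} → ¬ Separable p q → 0# < b q
    inseparable⇒0<b {p} {q} ¬sep = <-by (x<y⇒0<y-x (<-≤-trans (a<sum p) (≮⇒≥ ¬sep)))
      (solve 2 (λ x y → x :+ y :- x := y :- con (0 , 0)) refl (a p) (b q))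

    inseparable⇒≢ : ∀ {p q} → ¬ Separable p q → p ≢ q
    inseparable⇒≢ ¬pp ≡.refl = 0<x⇒x≉0 (inseparable⇒0<b ¬pp) (0<a⇒b≈0 (inseparable⇒0<a ¬pp))

    private
      -- Two disjoint inseparable pairs already exhaust Σ a + Σ b.
      overfull : ∀ {i i′ j j′} → ¬ Separable i j → ¬ Separable i′ j′ → ∀ {x y} →
                 0# < x + y → a i + (a i′ + x) ≤ sum a → b j + (b j′ + y) ≤ sum b → ∀ {A : Set} → A
      overfull {i} {i′} {j} {j′} ¬ij ¬i′j′ {x} {y} 0<x+y a≤ b≤ = contradiction
        (<-respʳ-≈ (begin
            ((((a i + b j) - T) + ((a i′ + b j′) - T)) + (T - (a i + (a i′ + x))) + (sum b - (b j + (b j′ + y)))) + (x + y)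
              ≈⟨ +-congʳ (+-congˡ (+-congʳ (sym sum-a≈b))) ⟩
            ((((a i + b j) - T) + ((a i′ + b j′) - T)) + (T - (a i + (a i′ + x))) + (T - (b j + (b j′ + y)))) + (x + y)
              ≈⟨ solve 7 (λ ai ai′ bj bj′ x y t →
                   ((((ai :+ bj) :- t) :+ ((ai′ :+ bj′) :- t)) :+ (t :- (ai :+ (ai′ :+ x))) :+ (t :- (bj :+ (bj′ :+ y)))) :+ (x :+ y)
                     := con (0 , 0)) refl (a i) (a i′) (b j) (b j′) x y T ⟩
            0# ∎)
          (nonneg+pos (nonneg+nonneg (nonneg+nonneg (nonneg+nonneg (x≤y⇒0≤y-x (≮⇒≥ ¬ij)) (x≤y⇒0≤y-x (≮⇒≥ ¬i′j′)))
            (x≤y⇒0≤y-x a≤)) (x≤y⇒0≤y-x b≤)) 0<x+y))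
        (<-irrefl refl)
        where T = sum a

    -- Violating pairs are edges between the supports of a and b, so two of them are disjoint as
    -- soon as both the first ends and the second ends differ. The search tries, in order: two
    -- disjoint edges, no edge, all edges through one first end, all edges through one second end.
    inseparable⊆star⊎square : Fin n →
      (∃[ m ] ∃[ j ] m ≢ j × (∀ {p q} → ¬ Separable p q → Star m j p q)) ⊎
      (∃[ i ] ∃[ i′ ] ∃[ j ] ∃[ j′ ] (∀ {p q} → ¬ Separable p q → Square i i′ j j′ p q))
    inseparable⊆star⊎square o
      with any? (λ i → any? λ i′ → any? λ j → any? λ j′ → ¬? (i′ Fin.≟ i) ×-dec ¬? (j′ Fin.≟ j) ×-dec
             ¬? (separable? i j) ×-dec ¬? (separable? i′ j′))
    ... | yes (i , i′ , j , j′ , i′≢i , j′≢j , ¬ij , ¬i′j′) =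
      inj₂ (i , i′ , j , j′ , λ ¬pq → inj₁ (left ¬pq , right ¬pq))
      where
      left : ∀ {p q} → ¬ Separable p q → p ≡ i ⊎ p ≡ i′
      left {p} ¬pq with p Fin.≟ i | p Fin.≟ i′
      ... | yes eq | _      = inj₁ eq
      ... | no _   | yes eq = inj₂ eq
      -- A third first end p would claim a p > 0 on top of the exhausted total.
      ... | no p≢i | no p≢i′ = overfull ¬ij ¬i′j′ {a p} {0#}
        (<-respʳ-≈ (sym (+-identityʳ _)) (inseparable⇒0<a ¬pq))
        (three≤sum a≥0 i′≢i p≢i p≢i′)
        (≤-respˡ-≈ (+-congˡ (sym (+-identityʳ _))) (two≤sum b≥0 j′≢j))
      right : ∀ {p q} → ¬ Separable p q → q ≡ j ⊎ q ≡ j′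
      right {q = q} ¬pq with q Fin.≟ j | q Fin.≟ j′
      ... | yes eq | _      = inj₁ eq
      ... | no _   | yes eq = inj₂ eq
      ... | no q≢j | no q≢j′ = overfull ¬ij ¬i′j′ {0#} {b q}
        (<-respʳ-≈ (sym (+-identityˡ _)) (inseparable⇒0<b ¬pq))
        (≤-respˡ-≈ (+-congˡ (sym (+-identityʳ _))) (two≤sum a≥0 i′≢i))
        (three≤sum b≥0 j′≢j q≢j q≢j′)
    ... | no ¬disjoint with any? (λ i → any? λ j → ¬? (separable? i j))
    -- Without edges any star is large enough; `o` and a second index provide one.
    ...   | no allSeparable = let j , j≢o , _ = a-another o in
      inj₁ (o , j , (j≢o ∘ ≡.sym) , λ ¬pq → contradiction (_ , _ , ¬pq) allSeparable)
    ...   | yes (i , j , ¬ij) with any? (λ i′ → any? λ j′ → ¬? (i′ Fin.≟ i) ×-dec ¬? (separable? i′ j′))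
    -- All edges start at i. The excluded point has a positive a-coefficient, so it is never a
    -- second end.
    ...     | no centre-i = let j₂ , j₂≢i , 0<aj₂ = a-another i in
      inj₁ (i , j₂ , (j₂≢i ∘ ≡.sym) , λ {p} {q} ¬pq →
        let p≡i = decidable-stable (p Fin.≟ i) (λ p≢i → centre-i (p , q , p≢i , ¬pq)) in
        inj₁ (p≡i , (λ q≡i → inseparable⇒≢ ¬pq (≡.trans p≡i (≡.sym q≡i))) ,
              λ { ≡.refl → 0<x⇒x≉0 (inseparable⇒0<b ¬pq) (0<a⇒b≈0 0<aj₂) }))
    -- Two edges with different first ends share their second end j, which is the centre.
    ...     | yes (i′ , j′ , i′≢i , ¬i′j′) = let j₂ , j₂≢j , 0<bj₂ = b-another j in
      inj₁ (j , j₂ , (j₂≢j ∘ ≡.sym) , λ {p} {q} ¬pq →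
        let q≡j = decidable-stable (q Fin.≟ j) (not-elsewhere ¬pq) in
        inj₂ (q≡j , (λ p≡j → inseparable⇒≢ ¬pq (≡.trans p≡j (≡.sym q≡j))) ,
              λ { ≡.refl → 0<x⇒x≉0 (inseparable⇒0<a ¬pq) (0<b⇒a≈0 0<bj₂) }))
      where
      apart : ∀ {i i′ j j′} → ¬ Separable i j → ¬ Separable i′ j′ → i′ ≢ i → ¬ j′ ≢ j
      apart ¬ij ¬i′j′ i′≢i j′≢j = ¬disjoint (_ , _ , _ , _ , i′≢i , j′≢j , ¬ij , ¬i′j′)
      -- An edge avoiding j must start at i, as otherwise it is disjoint from the edge i j; but then
      -- it is disjoint from the edge i′ j′, where j′ equals j.
      not-elsewhere : ∀ {p q} → ¬ Separable p q → ¬ q ≢ j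
      not-elsewhere {p} {q} ¬pq q≢j with p Fin.≟ i
      ... | no p≢i     = apart ¬ij ¬pq p≢i q≢j
      ... | yes ≡.refl = apart ¬i′j′ ¬pq (i′≢i ∘ ≡.sym)
        (λ { ≡.refl → apart ¬ij ¬i′j′ i′≢i q≢j })

    Antipodal : Fin n × Fin n → Set
    Antipodal (i , j) = Separable j i × Separable i j

    antipodal? : Decidable₁ Antipodal
    antipodal? (i , j) = separable? j i ×-dec separable? i j

    antipodalPairs : List (Fin n × Fin n)
    antipodalPairs = filter antipodal? (pairs n)

    antipodalPairs-unique : Unique antipodalPairs
    antipodalPairs-unique = Unique.filter⁺ antipodal? (pairs-unique n)

    ∈-antipodalPairs⁻ : ∀ {i j} → (i , j) ∈ₗ antipodalPairs → i Fin.< j × Antipodal (i , j)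
    ∈-antipodalPairs⁻ ij∈ = let ij∈pairs , ap = ∈-filter⁻ antipodal? {xs = pairs n} ij∈ in ∈-pairs⁻ ij∈pairs , ap

  module _ {e : Vector (Point 4) 6} (C : Circuit e) where

    open Circuit C

    private
      nonantipodal : ∀ {p q} → ¬ Antipodal C (p , q) → ¬ Separable p q ⊎ ¬ Separable q p
      nonantipodal {p} {q} ¬ap with separable? C p q | separable? C q p
      ... | no ¬pq | _       = inj₁ ¬pq
      ... | yes _  | no ¬qp  = inj₂ ¬qp
      ... | yes pq | yes qp  = contradiction (qp , pq) ¬ap

      -- Every non-antipodal pair violates an inequality in one direction, so it lies in the
      -- symmetric relation R; the pairs outside R are therefore antipodal.
      11≤outside⇒11≤antipodal : {R : Fin 6 → Fin 6 → Set} (R? : Decidable R) → (∀ {p q} → R p q → R q p) →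
                                (∀ {p q} → ¬ Separable p q → R p q) →
                                11 ℕ.≤ outside R? → 11 ℕ.≤ length (antipodalPairs C)
      11≤outside⇒11≤antipodal R? R-sym inseparable⊆R 11≤ = ℕ.≤-trans 11≤
        (length-filter-mono (λ (p , q) → ¬? (R? p q)) (antipodal? C)
          (λ {(p , q)} ¬R → decidable-stable (antipodal? C (p , q))
            (λ ¬ap → ¬R ([ inseparable⊆R , R-sym ∘ inseparable⊆R ]′ (nonantipodal ¬ap))))
          (pairs 6))

      star-case : ∀ m j → m ≢ j → (∀ {p q} → ¬ Separable p q → Star m j p q) → 11 ℕ.≤ length (antipodalPairs C)
      star-case m j m≢j ⊆star = [
        (λ m≡j → contradiction m≡j m≢j) ,
        11≤outside⇒11≤antipodal {Star m j} (star? m j) Sum.swap ⊆star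
        ]′ (outside-star m j)

      square-case : ∀ i i′ j j′ → (∀ {p q} → ¬ Separable p q → Square i i′ j j′ p q) →
                    11 ℕ.≤ length (antipodalPairs C)
      square-case i i′ j j′ ⊆square =
        11≤outside⇒11≤antipodal {Square i i′ j j′} (square? i i′ j j′) Sum.swap ⊆square (outside-square i i′ j j′)

    11≤antipodalPairs : 11 ℕ.≤ length (antipodalPairs C)
    11≤antipodalPairs = [
      (λ (m , j , m≢j , ⊆star) → star-case m j m≢j ⊆star) ,
      (λ (i , i′ , j , j′ , ⊆square) → square-case i i′ j j′ ⊆square)
      ]′ (inseparable⊆star⊎square C zero)

    -- The opposite estimate, for the examples: a relation consisting of violating pairs bounds the
    -- number of antipodal pairs from above.
    antipodalPairs≤outside : {R : Fin 6 → Fin 6 → Set} (R? : Decidable R) →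
                             (∀ {p q} → R p q → ¬ Separable p q ⊎ ¬ Separable q p) →
                             length (antipodalPairs C) ℕ.≤ outside R?
    antipodalPairs≤outside R? R⇒ = length-filter-mono (antipodal? C) (λ (p , q) → ¬? (R? p q))
      (λ (qp , pq) r → [ (λ ¬pq → ¬pq pq) , (λ ¬qp → ¬qp qp) ]′ (R⇒ r)) (pairs 6)

  module _ {e : Vector (Point d) (suc (suc d))} (frame : Coordinates e) (C : Circuit e)
           {X : Subset d} (X≐ : X ≐ range e) where

    private
      ends : Fin (length (antipodalPairs C)) → Fin (suc (suc d)) × Fin (suc (suc d))
      ends = lookup (antipodalPairs C)

      Ends : Fin (length (antipodalPairs C)) → Point d × Point d
      Ends k = e (proj₁ (ends k)) , e (proj₂ (ends k))

      injective : Injective _≡_ SameUnorderedPair Ends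
      injective {k} {l} same = lookup-injective (antipodalPairs-unique C) (equal same)
        where
        i<j : ∀ k → proj₁ (ends k) Fin.< proj₂ (ends k)
        i<j k = proj₁ (∈-antipodalPairs⁻ C (∈-lookup k))
        inj : Injective _≡_ _≋_ e
        inj = circuit⇒injective frame C
        equal : SameUnorderedPair (Ends k) (Ends l) → ends k ≡ ends l
        equal (inj₁ (p , q)) = ≡.cong₂ _,_ (inj p) (inj q)
        -- Listed pairs are increasing, so none is the reversal of another.
        equal (inj₂ (p , q)) = contradiction (i<j l)
          (Fin.<-asym (≡.subst₂ Fin._<_ (inj p) (inj q) (i<j k)))

      fromIndex : ∀ {i j} (ij∈ : (i , j) ∈ₗ antipodalPairs C) → Ends (index ij∈) ≡ (e i , e j)
      fromIndex ij∈ = ≡.cong (λ (i , j) → e i , e j) (≡.sym (lookup-index ij∈))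

      complete′ : ∀ {p q} → StrictlyAntipodal X p q → ∃[ k ] SameUnorderedPair (p , q) (Ends k)
      complete′ {p} {q} sa@(p∈X , q∈X , _) = found (proj₁ X≐ p∈X) (proj₁ X≐ q∈X)
        where
        found : p ∈ range e → q ∈ range e → ∃[ k ] SameUnorderedPair (p , q) (Ends k)
        found (i , p≋) (j , q≋) with Fin.<-cmp i j
        ... | tri< i<j _ _ =
          let _ , ap = antipodal⇒separable frame C X≐ sa p≋ q≋
              ij∈ = ∈-filter⁺ (antipodal? C) (∈-pairs⁺ i<j) ap
          in index ij∈ , ≡.subst (SameUnorderedPair (p , q)) (≡.sym (fromIndex ij∈)) (inj₁ (p≋ , q≋))
        ... | tri≈ _ i≡j _ = contradiction i≡j (proj₁ (antipodal⇒separable frame C X≐ sa p≋ q≋))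
        ... | tri> _ _ j<i =
          let _ , ji , ij = antipodal⇒separable frame C X≐ sa p≋ q≋
              ji∈ = ∈-filter⁺ (antipodal? C) (∈-pairs⁺ j<i) (ij , ji)
          in index ji∈ , ≡.subst (SameUnorderedPair (p , q)) (≡.sym (fromIndex ji∈)) (inj₂ (p≋ , q≋))

      sound : ∀ {p q} → ∃[ k ] SameUnorderedPair (p , q) (Ends k) → StrictlyAntipodal X p q
      sound {p} {q} (k , same) = orient same
        where
        ends∈ = ∈-antipodalPairs⁻ C (∈-lookup k)
        i≢j : proj₁ (ends k) ≢ proj₂ (ends k)
        i≢j = Fin.<⇒≢ (proj₁ ends∈)
        orient : SameUnorderedPair (p , q) (Ends k) → StrictlyAntipodal X p q
        orient (inj₁ (p≋ , q≋)) =
          separable⇒antipodal frame C X≐ i≢j (proj₁ (proj₂ ends∈)) (proj₂ (proj₂ ends∈)) p≋ q≋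
        orient (inj₂ (p≋ , q≋)) =
          separable⇒antipodal frame C X≐ (i≢j ∘ ≡.sym) (proj₂ (proj₂ ends∈)) (proj₁ (proj₂ ends∈)) p≋ q≋

    Sa-antipodalPairs : Sa X (length (antipodalPairs C))
    Sa-antipodalPairs = Ends , injective , complete′ , sound

-- The minimum for six points in dimension four, and the two families attaining it.

module SixPoints (ℝ : RealNumbers) where

  open RealNumbers ℝ
  open OrderedField ℝ
  open Convex ℝ
  open LinearAlgebra ℝ
  open AffineGeometry ℝ
  open Circuits ℝ
  open Faces ℝ
  open Pairs
  open Antipodality ℝ
  open import Relation.Binary.Reasoning.Setoid setoid
  private module Σ = SemiringSum semiring

  private
    variable
      d n : ℕ

  module _ {e : Vector (Point 4) 6} (frame : Coordinates e) (C : Circuit e) where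

    strictlyConvex : {X : Subset 4} → X ≐ range e → X ∈ 𝒞ˢ 4 6
    strictlyConvex {X} X≐ =
      (e , circuit⇒injective frame C , X≐) ,
      (λ p → aff-mono {S = range e} {X} (proj₂ X≐) (AffineHull⊆aff-range {e = e} {p}
        (Coordinates.coordinates frame p , Coordinates.sum-coordinates frame p ,
         ≋-sym (Coordinates.linComb-coordinates frame p)))) ,
      (λ {x} → proj₂ vertices {x} ∘ proj₁ X≐ {x}) , (λ {x} → proj₂ X≐ {x} ∘ proj₁ vertices {x})
      where
      vertices : vert (conv X) ≐ range e
      vertices = vert≐range frame C (Between-conv X≐)

    -- An example only has to exhibit enough violating pairs; the general lower bound supplies the
    -- other inequality.
    attains : {R : Fin 6 → Fin 6 → Set} (R? : Decidable R) →
              (∀ {p q} → R p q → ¬ Circuit.Separable C p q ⊎ ¬ Circuit.Separable C q p) →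
              outside R? ℕ.≤ 11 → {X : Subset 4} → X ≐ range e → Attains 4 6 11 X
    attains R? R⇒ ≤11 {X} X≐ = strictlyConvex X≐ ,
      ≡.subst (Sa X) (ℕ.≤-antisym (ℕ.≤-trans (antipodalPairs≤outside C R? R⇒) ≤11) (11≤antipodalPairs C))
        (Sa-antipodalPairs frame C X≐)

  lowerBound : ∀ X → X ∈ 𝒞ˢ 4 6 → ∃[ m ] Sa X m × 11 ℕ.≤ m
  lowerBound X ((e , inj , X≐) , span , vertices) =
    length (antipodalPairs C) , Sa-antipodalPairs frame C X≐ , 11≤antipodalPairs C
    where
    frame : Coordinates e
    frame = spanning⇒Coordinates (λ p → aff⊆AffineHull {S = X} {e} (range⊆AffineHull {e = e} ∘ proj₁ X≐) (span p))
    C : Circuit e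
    C = vertices⇒Circuit X≐ inj (proj₁ vertices)

  module DoublePyramid (a b c e v w : Point 4) (a+c≋b+e : (λ i → a i + c i) ≋ (λ i → b i + e i)) where

    points : Vector (Point 4) 6
    points = a ∷ b ∷ c ∷ e ∷ v ∷ w ∷ []

    circuit : Circuit points
    circuit = record
      { a = α ; b = β ; a≥0 = α≥0 ; b≥0 = β≥0
      ; disjoint = λ { 0F → inj₂ refl ; 1F → inj₁ refl ; 2F → inj₂ refl ; 3F → inj₁ refl ; 4F → inj₁ refl ; 5F → inj₁ refl }
      ; sum-a≈b = solve 0 (o :+ (z :+ (o :+ (z :+ (z :+ (z :+ z))))) := z :+ (o :+ (z :+ (o :+ (z :+ (z :+ z)))))) refl
      ; comb-a≋b = λ i → begin
          linComb α points i
            ≈⟨ solve 6 (λ a b c e v w → o :* a :+ (z :* b :+ (o :* c :+ (z :* e :+ (z :* v :+ (z :* w :+ z))))) := a :+ c)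
                 refl (a i) (b i) (c i) (e i) (v i) (w i) ⟩
          a i + c i    ≈⟨ a+c≋b+e i ⟩
          b i + e i
            ≈⟨ solve 6 (λ a b c e v w → b :+ e := z :* a :+ (o :* b :+ (z :* c :+ (o :* e :+ (z :* v :+ (z :* w :+ z))))))
                 refl (a i) (b i) (c i) (e i) (v i) (w i) ⟩
          linComb β points i   ∎
      ; a<sum = λ i → another⇒term<sum α≥0 (α-another i)
      ; b<sum = λ i → another⇒term<sum β≥0 (β-another i)
      }
      where
      o z : ∀ {n} → Polynomial n
      o {n} = con {n} (1 , 0)
      z {n} = con {n} (0 , 0)
      -- The parallelogram identity a + c = b + e is the dependence; both apexes get coefficient 0,
      -- and T = 2.
      α β : Point 6
      α = 1# ∷ 0# ∷ 1# ∷ 0# ∷ 0# ∷ 0# ∷ []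
      β = 0# ∷ 1# ∷ 0# ∷ 1# ∷ 0# ∷ 0# ∷ []
      α≥0 : ∀ i → 0# ≤ α i
      α≥0 = λ { 0F → inj₁ 0<1 ; 1F → ≤-refl ; 2F → inj₁ 0<1 ; 3F → ≤-refl ; 4F → ≤-refl ; 5F → ≤-refl }
      β≥0 : ∀ i → 0# ≤ β i
      β≥0 = λ { 0F → ≤-refl ; 1F → inj₁ 0<1 ; 2F → ≤-refl ; 3F → inj₁ 0<1 ; 4F → ≤-refl ; 5F → ≤-refl }
      α-another : ∀ i → ∃[ k ] k ≢ i × 0# < α k
      α-another zero    = 2F , (λ ()) , 0<1
      α-another (suc i) = 0F , (λ ()) , 0<1
      β-another : ∀ i → ∃[ k ] k ≢ i × 0# < β k
      β-another 0F            = 1F , (λ ()) , 0<1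
      β-another 1F            = 3F , (λ ()) , 0<1
      β-another (suc (suc i)) = 1F , (λ ()) , 0<1

    -- Opposite corners carry coefficient 1 on the same side, so adjacent corners reach 1 + 1 = T
    -- exactly.
    square⇒inseparable : ∀ {p q} → (p ≡ 0F ⊎ p ≡ 2F) × (q ≡ 1F ⊎ q ≡ 3F) → ¬ Circuit.Separable circuit p q
    square⇒inseparable = λ
      { (inj₁ ≡.refl , inj₁ ≡.refl) → <-irrefl two
      ; (inj₁ ≡.refl , inj₂ ≡.refl) → <-irrefl two
      ; (inj₂ ≡.refl , inj₁ ≡.refl) → <-irrefl two
      ; (inj₂ ≡.refl , inj₂ ≡.refl) → <-irrefl two
      }
      where
      two : 1# + 1# ≈ sum (Circuit.a circuit)
      two = solve 0 (con (1 , 0) :+ con (1 , 0) := con (1 , 0) :+ (con (0 , 0) :+ (con (1 , 0) :+ (con (0 , 0) :+ (con (0 , 0) :+ (con (0 , 0) :+ con (0 , 0))))))) refl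

    attains-11 : Coordinates points → {X : Subset 4} → X ≐ range points → Attains 4 6 11 X
    attains-11 frame = attains frame circuit (square? 0F 2F 1F 3F)
      [ inj₁ ∘ square⇒inseparable , inj₂ ∘ square⇒inseparable ]′
      (from-yes (outside (square? {6} 0F 2F 1F 3F) ℕ.≤? 11))

  range⊆⇒Coordinates : {e : Vector (Point d) (suc d)} {e′ : Vector (Point d) n} →
                       AffinelyIndependent e → range e ⊆ range e′ → Coordinates e′
  range⊆⇒Coordinates {e = e} {e′} indep e⊆e′ = spanning⇒Coordinates (λ p →
    aff⊆AffineHull {S = range e} {e′} (range⊆AffineHull {e = e′} ∘ e⊆e′)
      (AffineHull⊆aff-range {e = e} {p} (independent⇒spanning {e = e} indep p)))

  attained : ∃[ X ] Attains 4 6 11 X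
  attained = range points , attains-11 (spanning⇒Coordinates span) ((λ p → p) , (λ p → p))
    where
    -- The unit square in the first two coordinates, with the other two unit vectors as apexes.
    open DoublePyramid (λ _ → 0#) (unit 0F) (λ i → unit 0F i + unit 1F i) (unit 1F) (unit 2F) (unit 3F)
      (λ _ → +-identityˡ _)
    span : Universal (AffineHull points)
    -- Barycentric weights for the origin and the four unit vectors; the remaining corner of the
    -- square gets weight 0.
    span p = (1# - (p 0F + (p 1F + (p 2F + p 3F)))) ∷ p 0F ∷ 0# ∷ p 1F ∷ p 2F ∷ p 3F ∷ [] ,
      solve 4 (λ a b c d → o :- (a :+ (b :+ (c :+ d))) :+ (a :+ (z :+ (b :+ (c :+ (d :+ z))))) := o) refl
        (p 0F) (p 1F) (p 2F) (p 3F) ,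
      λ
        { 0F → solve 4 (λ a b c d → a := (o :- (a :+ (b :+ (c :+ d)))) :* z :+ (a :* o :+ (z :* (o :+ z) :+ (b :* z :+ (c :* z :+ (d :* z :+ z)))))) refl
               (p 0F) (p 1F) (p 2F) (p 3F)
        ; 1F → solve 4 (λ a b c d → b := (o :- (a :+ (b :+ (c :+ d)))) :* z :+ (a :* z :+ (z :* (z :+ o) :+ (b :* o :+ (c :* z :+ (d :* z :+ z)))))) refl
               (p 0F) (p 1F) (p 2F) (p 3F)
        ; 2F → solve 4 (λ a b c d → c := (o :- (a :+ (b :+ (c :+ d)))) :* z :+ (a :* z :+ (z :* (z :+ z) :+ (b :* z :+ (c :* o :+ (d :* z :+ z)))))) refl
               (p 0F) (p 1F) (p 2F) (p 3F)
        ; 3F → solve 4 (λ a b c d → d := (o :- (a :+ (b :+ (c :+ d)))) :* z :+ (a :* z :+ (z :* (z :+ z) :+ (b :* z :+ (c :* z :+ (d :* o :+ z)))))) refl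
               (p 0F) (p 1F) (p 2F) (p 3F)
        }
      where
      o z : ∀ {n} → Polynomial n
      o {n} = con {n} (1 , 0)
      z {n} = con {n} (0 , 0)

  -- Three corners and the two apexes form an affine basis, because each apex leaves the hull of
  -- what precedes it. The layers are known only up to equality of sets, so P is sandwiched between
  -- the six points and their hull.
  doublePyramid : (B P : Subset 4) → IsParallelogram B → IsPyramid B 2 P → Attains 4 6 11 (vert P)
  doublePyramid B P (a , b , c , e , indep , a+c≋b+e , B⊆ , ⊆B)
      (apex {Q = Q₁} w (apex {Q = Q₀} v (base (Q₀⊆B , B⊆Q₀)) v∉ (Q₁⊆ , ⊆Q₁)) w∉ (P⊆ , ⊆P)) =
    attains-11 frame (vert≐range frame circuit record { range⊆ = range⊆P ; ⊆hull = P⊆hull })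
    where
    open DoublePyramid a b c e v w a+c≋b+e
    corners : Vector (Point 4) 4
    corners = a ∷ b ∷ c ∷ e ∷ []
    corners⊆Q₀ : range corners ⊆ Q₀
    corners⊆Q₀ = B⊆Q₀ ∘ ⊆B ∘ S⊆conv {S = range corners}
    Q₀⊆Q₁ : Q₀ ⊆ Q₁
    Q₀⊆Q₁ = ⊆Q₁ ∘ S⊆conv {S = Q₀ ∪ ｛ v ｝} ∘ inj₁
    v∈Q₁ : ｛ v ｝ ⊆ Q₁
    v∈Q₁ = ⊆Q₁ ∘ S⊆conv {S = Q₀ ∪ ｛ v ｝} ∘ inj₂
    corner∈Q₀ : ∀ k → corners k ∈ Q₀
    corner∈Q₀ k = corners⊆Q₀ (k , λ _ → refl)
    independent : AffinelyIndependent (w ∷ v ∷ a ∷ b ∷ c ∷ [])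
    independent = independent-∷ {S = Q₁} {w} {v ∷ a ∷ b ∷ c ∷ []}
      (independent-∷ {S = Q₀} {v} {a ∷ b ∷ c ∷ []} indep
        (λ { 0F → corner∈Q₀ 0F ; 1F → corner∈Q₀ 1F ; 2F → corner∈Q₀ 2F }) v∉)
      (λ { 0F → v∈Q₁ {v} (λ _ → refl) ; 1F → Q₀⊆Q₁ (corner∈Q₀ 0F) ; 2F → Q₀⊆Q₁ (corner∈Q₀ 1F)
         ; 3F → Q₀⊆Q₁ (corner∈Q₀ 2F) }) w∉
    basis⊆points : range (w ∷ v ∷ a ∷ b ∷ c ∷ []) ⊆ range points
    basis⊆points = λ
      { (0F , p) → 5F , p
      ; (1F , p) → 4F , p
      ; (2F , p) → 0F , p
      ; (3F , p) → 1F , p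
      ; (4F , p) → 2F , p
      }
    frame : Coordinates points
    frame = range⊆⇒Coordinates {e = w ∷ v ∷ a ∷ b ∷ c ∷ []} {points} independent basis⊆points
    Q₁⊆P : Q₁ ⊆ P
    Q₁⊆P = ⊆P ∘ S⊆conv {S = Q₁ ∪ ｛ w ｝} ∘ inj₁
    corners⊆P : range corners ⊆ P
    corners⊆P = Q₁⊆P ∘ Q₀⊆Q₁ ∘ corners⊆Q₀
    range⊆P : range points ⊆ P
    range⊆P = λ
      { (0F , p) → corners⊆P (0F , p)
      ; (1F , p) → corners⊆P (1F , p)
      ; (2F , p) → corners⊆P (2F , p)
      ; (3F , p) → corners⊆P (3F , p)
      ; (4F , p) → Q₁⊆P (v∈Q₁ p)
      ; (5F , p) → ⊆P (S⊆conv {S = Q₁ ∪ ｛ w ｝} (inj₂ p))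
      }
    corners⊆hull : range corners ⊆ ConvexHull points
    corners⊆hull = range⊆ConvexHull {e = points} ∘ λ
      { (0F , p) → 0F , p
      ; (1F , p) → 1F , p
      ; (2F , p) → 2F , p
      ; (3F , p) → 3F , p
      }
    Q₁⊆hull : Q₁ ⊆ ConvexHull points
    Q₁⊆hull = conv⊆ConvexHull {S = Q₀ ∪ ｛ v ｝} {points} (λ
      { (inj₁ p∈Q₀) → conv⊆ConvexHull {S = range corners} {points} corners⊆hull (B⊆ (Q₀⊆B p∈Q₀))
      ; (inj₂ p≋v)  → range⊆ConvexHull {e = points} (4F , p≋v)
      }) ∘ Q₁⊆
    P⊆hull : P ⊆ ConvexHull points
    P⊆hull = conv⊆ConvexHull {S = Q₁ ∪ ｛ w ｝} {points} (λ
      { (inj₁ p∈Q₁) → Q₁⊆hull p∈Q₁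
      ; (inj₂ p≋w)  → range⊆ConvexHull {e = points} (5F , p≋w)
      }) ∘ P⊆

  ⟨⟩-self-nonneg : (u : Point n) → 0# ≤ ⟨ u , u ⟩
  ⟨⟩-self-nonneg u = sum-nonneg (λ i → 0≤x² (u i))

  ⟨⟩-square : (r : Carrier) (x v : Point n) →
              ⟨ (λ c → r * x c + v c) , (λ c → r * x c + v c) ⟩ ≈
              r * r * ⟨ x , x ⟩ + ((r + r) * ⟨ x , v ⟩ + ⟨ v , v ⟩)
  ⟨⟩-square r x v = begin
    ⟨ (λ c → r * x c + v c) , (λ c → r * x c + v c) ⟩
      ≈⟨ sum-cong (λ c → solve 3 (λ r x v → (r :* x :+ v) :* (r :* x :+ v) := r :* r :* (x :* x) :+ ((r :+ r) :* (x :* v) :+ v :* v)) refl r (x c) (v c)) ⟩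
    sum (λ c → r * r * (x c * x c) + ((r + r) * (x c * v c) + v c * v c))
      ≈⟨ sum-+ (λ c → r * r * (x c * x c)) (λ c → (r + r) * (x c * v c) + v c * v c) ⟩
    sum (λ c → r * r * (x c * x c)) + sum (λ c → (r + r) * (x c * v c) + v c * v c)
      ≈⟨ +-cong (sum-*ˡ (r * r) (λ c → x c * x c))
           (trans (sum-+ (λ c → (r + r) * (x c * v c)) (λ c → v c * v c)) (+-congʳ (sum-*ˡ (r + r) (λ c → x c * v c)))) ⟩
    r * r * ⟨ x , x ⟩ + ((r + r) * ⟨ x , v ⟩ + ⟨ v , v ⟩) ∎

  private
    -- The barycentre of the facet has barycentric coordinate 1/4 at the four vertices of the facet
    -- and 0 at the fifth; a tolerance of 1/8 keeps the two kinds apart.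
    4# 8# : Carrier
    4# = (1# + 1#) + (1# + 1#)
    8# = 4# + 4#

    0<8 : 0# < 8#
    0<8 = pos+nonneg 0<4 (inj₁ 0<4)
      where
      0<2 = pos+nonneg 0<1 (inj₁ 0<1)
      0<4 = pos+nonneg 0<2 (inj₁ 0<2)

  -- With B = 1 + Σ |vₖ|² and ε = 1/(4B), this is the expansion of |x/ε + vₖ|² ≥ 0.
  smallPairings : (v : Vector (Point d) n) → ∃[ ε ] 0# < ε ×
                  (∀ x → ⟨ x , x ⟩ < ε * ε → ∀ k → 0# < 1# + 8# * ⟨ x , v k ⟩)
  smallPairings {n = n} v = ε , 0<ε , bound
    where
    norms : Point n
    norms k = ⟨ v k , v k ⟩
    norms≥0 : ∀ k → 0# ≤ norms k
    norms≥0 k = ⟨⟩-self-nonneg (v k)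
    B = 1# + sum norms
    0<B : 0# < B
    0<B = pos+nonneg 0<1 (sum-nonneg norms≥0)
    -- The cross term of the expansion has factor 2r, and r = 4B makes it 8B, so that B can be
    -- cancelled at the end.
    r = (B + B) + (B + B)
    0<r : 0# < r
    0<r = pos+nonneg 0<2B (inj₁ 0<2B)
      where 0<2B = pos+nonneg 0<B (inj₁ 0<B)
    r⁻¹ = inverse r (0<x⇒x≉0 0<r)
    ε = proj₁ r⁻¹
    rε≈1 : r * ε ≈ 1#
    rε≈1 = proj₂ r⁻¹
    0<ε : 0# < ε
    0<ε = *-cancel-pos 0<r (<-respʳ-≈ (sym rε≈1) 0<1)
    bound : ∀ x → ⟨ x , x ⟩ < ε * ε → ∀ k → 0# < 1# + 8# * ⟨ x , v k ⟩
    -- Three nonnegative quantities are added, the first of them positive: the slack of `near`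
    -- scaled by r², the squared norms of the other vectors, and |r x + v k|². The terms in |x|² and
    -- |v k|² cancel.
    bound x near k = *-cancel-pos 0<B (<-respʳ-≈ (begin
      r * r * (ε * ε - X) + ((sum norms - norms k) + (r * r * X + ((r + r) * Y + norms k)))
        ≈⟨ solve 6 (λ r ε X N s Y → r :* r :* (ε :* ε :- X) :+ ((s :- N) :+ (r :* r :* X :+ ((r :+ r) :* Y :+ N)))
             := (r :* ε) :* (r :* ε) :+ (s :+ (r :+ r) :* Y)) refl r ε X (norms k) (sum norms) Y ⟩
      (r * ε) * (r * ε) + (sum norms + (r + r) * Y)
        ≈⟨ +-congʳ (trans (*-cong rε≈1 rε≈1) (*-identityˡ 1#)) ⟩
      1# + (sum norms + (r + r) * Y)
        ≈⟨ solve 2 (λ s Y → let o = con (1 , 0) ; B = o :+ s ; r = (B :+ B) :+ (B :+ B) ; four = (o :+ o) :+ (o :+ o) in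
             o :+ (s :+ (r :+ r) :* Y) := B :* (o :+ (four :+ four) :* Y)) refl (sum norms) Y ⟩
      B * (1# + 8# * Y) ∎)
      (pos+nonneg (*-pos (*-pos 0<r 0<r) (x<y⇒0<y-x near))
        (nonneg+nonneg (x≤y⇒0≤y-x (term≤sum norms≥0 k))
          (≤-respʳ-≈ (⟨⟩-square r x (v k)) (⟨⟩-self-nonneg (λ c → r * x c + v k c))))))
      where
      X = ⟨ x , x ⟩
      Y = ⟨ x , v k ⟩

  module CappedSimplex (s : Vector (Point 4) 5) (i : Fin 5) (p : Point 4) (β : Point 5)
                       (Σβ≈1 : sum β ≈ 1#) (βs≋p : linComb β s ≋ p) (βi<0 : β i < 0#)
                       (0<β : ∀ k → 0# < β (punchIn i k)) where

    points : Vector (Point 4) 6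
    points = p ∷ s i ∷ removeAt s i

    circuit : Circuit points
    circuit = record
      { a = α ; b = γ ; a≥0 = α≥0 ; b≥0 = γ≥0
      ; disjoint = λ { 0F → inj₂ refl ; 1F → inj₂ refl ; (suc (suc k)) → inj₁ refl }
      ; sum-a≈b = begin
          1# + (- β i + sum (replicate 4 0#))    ≈⟨ +-cong (sym Σβ≈1) (+-congˡ (sum-0 {f = replicate 4 0#} (λ _ → refl))) ⟩
          sum β + (- β i + 0#)                   ≈⟨ +-congʳ (Σ.sum-remove {i = i} β) ⟩
          (β i + sum (removeAt β i)) + (- β i + 0#)
            ≈⟨ solve 2 (λ b s → (b :+ s) :+ (:- b :+ con (0 , 0)) := con (0 , 0) :+ (con (0 , 0) :+ s)) refl (β i) _ ⟩
          0# + (0# + sum (removeAt β i))         ∎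
      ; comb-a≋b = λ c → begin
          1# * p c + (- β i * s i c + linComb (replicate 4 0#) (removeAt s i) c)
            ≈⟨ +-cong (trans (*-identityˡ _) (sym (βs≋p c))) (+-congˡ (sum-0 (λ k → zeroˡ (removeAt s i k c)))) ⟩
          linComb β s c + (- β i * s i c + 0#)
            ≈⟨ +-congʳ (Σ.sum-remove {i = i} (λ k → β k * s k c)) ⟩
          (β i * s i c + linComb (removeAt β i) (removeAt s i) c) + (- β i * s i c + 0#)
            ≈⟨ solve 4 (λ b x t q → (b :* x :+ t) :+ ((:- b) :* x :+ con (0 , 0)) := con (0 , 0) :* q :+ (con (0 , 0) :* x :+ t)) refl
                 (β i) (s i c) _ (p c) ⟩
          0# * p c + (0# * s i c + linComb (removeAt β i) (removeAt s i) c) ∎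
      ; a<sum = λ k → another⇒term<sum α≥0 (α-another k)
      ; b<sum = λ k → another⇒term<sum γ≥0 (γ-another k)
      }
      where
      -- The only negative term of p = Σ β k s k is moved to the other side, so p and s i face the
      -- four facet vertices, and T = 1 - β i.
      α γ : Point 6
      α = 1# ∷ - β i ∷ replicate 4 0#
      γ = 0# ∷ 0# ∷ removeAt β i
      0<-βi : 0# < - β i
      0<-βi = neg⇒0<- βi<0
      α≥0 : ∀ k → 0# ≤ α k
      α≥0 = λ { 0F → inj₁ 0<1 ; 1F → inj₁ 0<-βi ; (suc (suc k)) → ≤-refl }
      γ≥0 : ∀ k → 0# ≤ γ k
      γ≥0 = λ { 0F → ≤-refl ; 1F → ≤-refl ; (suc (suc k)) → inj₁ (0<β k) }
      α-another : ∀ k → ∃[ l ] l ≢ k × 0# < α l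
      α-another zero    = 1F , (λ ()) , 0<-βi
      α-another (suc k) = 0F , (λ ()) , 0<1
      γ-another : ∀ k → ∃[ l ] l ≢ k × 0# < γ l
      γ-another 0F                  = 2F , (λ ()) , 0<β 0F
      γ-another 1F                  = 2F , (λ ()) , 0<β 0F
      γ-another 2F                  = 3F , (λ ()) , 0<β 1F
      γ-another (suc (suc (suc k))) = 2F , (λ ()) , 0<β 0F

    range-s⊆range-points : range s ⊆ range points
    range-s⊆range-points (k , q≋) with i Fin.≟ k
    ... | yes ≡.refl = 1F , q≋
    ... | no i≢k     = suc (suc (punchOut i≢k)) ,
      ≋-trans q≋ (λ c → reflexive (≡.cong (λ l → s l c) (≡.sym (punchIn-punchOut i≢k))))

    between : Between points (conv (conv (range s) ∪ ｛ p ｝))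
    between = record
      { range⊆ = λ
          { (0F , q≋)          → S⊆conv {S = S} (inj₂ q≋)
          ; (1F , q≋)          → S⊆conv {S = S} (inj₁ (S⊆conv {S = range s} (i , q≋)))
          ; (suc (suc k) , q≋) → S⊆conv {S = S} (inj₁ (S⊆conv {S = range s} (punchIn i k , q≋)))
          }
      ; ⊆hull = conv⊆ConvexHull {S = S} {points} λ
          { (inj₁ q∈) → conv⊆ConvexHull {S = range s} {points} (λ {q} q∈s → range⊆ConvexHull {e = points} {q} (range-s⊆range-points q∈s)) q∈
          ; (inj₂ q≋) → range⊆ConvexHull {e = points} (0F , q≋)
          }
      }
      where
      S : Subset 4
      S = conv (range s) ∪ ｛ p ｝

    module _ (-βi<β : ∀ k → - β i < β (punchIn i k)) where

      private
        -- As p has coefficient 1 and T = 1 - β i, separability would say β k < - β i at the facet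
        -- vertex k.
        inseparable : ∀ k → ¬ Circuit.Separable circuit 0F (suc (suc k))
        inseparable k sep = <-asym (-βi<β k) (<-by (x<y⇒0<y-x sep)
          (solve 2 (λ b g → let o = con (1 , 0) ; z = con (0 , 0) in
             (o :+ (:- b :+ (z :+ (z :+ (z :+ (z :+ z)))))) :- (o :+ g) := :- b :- g) refl (β i) (β (punchIn i k))))

        star⇒inseparable : ∀ {q} → q ≢ 0F → q ≢ 1F → ¬ Circuit.Separable circuit 0F q
        star⇒inseparable {0F}          q≢0 _   = contradiction ≡.refl q≢0
        star⇒inseparable {1F}          _   q≢1 = contradiction ≡.refl q≢1
        star⇒inseparable {suc (suc k)} _   _   = inseparable k

      attains-11 : AffinelyIndependent s → Attains 4 6 11 (vert (conv (conv (range s) ∪ ｛ p ｝)))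
      attains-11 indep = attains frame circuit (star? 0F 1F)
        (λ { (inj₁ (≡.refl , q≢0 , q≢1)) → inj₁ (star⇒inseparable q≢0 q≢1)
           ; (inj₂ (≡.refl , p≢0 , p≢1)) → inj₂ (star⇒inseparable p≢0 p≢1) })
        (from-yes (outside (star? {6} 0F 1F) ℕ.≤? 11))
        (vert≐range frame circuit between)
        where
        frame : Coordinates points
        frame = range⊆⇒Coordinates {e = s} {points} indep range-s⊆range-points

  module _ (s : Vector (Point 4) 5) (indep : AffinelyIndependent s) (i : Fin 5) (g : Point 4)
           (barycentre : IsBarycentre (removeAt s i) g) where

    private
      frame : Coordinates s
      frame = spanning⇒Coordinates {e = s} (independent⇒spanning {e = s} indep)
      open Coordinates frame

      facet : Point 5
      facet = insertAt (λ _ → 1#) i 0#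

      -- The difference is an affine relation on s, both terms having sum 4 and combining s to 4 g;
      -- independence makes it vanish. Multiplying by 4 avoids the fraction 1/4.
      coordinates-barycentre : ∀ k → 4# * coordinates g k - facet k ≈ 0#
      coordinates-barycentre = indep (λ k → 4# * coordinates g k - facet k)
        (begin
          sum (λ k → 4# * coordinates g k - facet k)
            ≈⟨ sum-minus (λ k → 4# * coordinates g k) facet ⟩
          sum (λ k → 4# * coordinates g k) - sum facet
            ≈⟨ +-cong (trans (sum-*ˡ 4# (coordinates g)) (*-congˡ (sum-coordinates g))) (-‿cong (sum-insertAt (λ _ → 1#) i 0#)) ⟩
          4# * 1# - (0# + sum (replicate 4 1#))
            ≈⟨ solve 0 (let o = con (1 , 0) ; z = con (0 , 0) in
                 ((o :+ o) :+ (o :+ o)) :* o :- (z :+ (o :+ (o :+ (o :+ (o :+ z))))) := z) refl ⟩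
          0# ∎)
        (λ c → begin
          ⟨ (λ k → 4# * coordinates g k - facet k) , (λ k → s k c) ⟩
            ≈⟨ ⟨⟩-minusˡ (λ k → 4# * coordinates g k) facet (λ k → s k c) ⟩
          ⟨ (λ k → 4# * coordinates g k) , (λ k → s k c) ⟩ - ⟨ facet , (λ k → s k c) ⟩
            ≈⟨ +-cong (trans (⟨⟩-*ˡ 4# (coordinates g) (λ k → s k c)) (*-congˡ (linComb-coordinates g c))) (-‿cong (facet-sum c)) ⟩
          4# * g c - sum (replicate 4 (g c))
            ≈⟨ solve 1 (λ g → let o = con (1 , 0) ; z = con (0 , 0) in
                 ((o :+ o) :+ (o :+ o)) :* g :- (g :+ (g :+ (g :+ (g :+ z)))) := z) refl (g c) ⟩
          0# ∎)
        where
        facet-sum : ∀ c → ⟨ facet , (λ k → s k c) ⟩ ≈ sum (replicate 4 (g c))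
        facet-sum c = begin
          ⟨ facet , (λ k → s k c) ⟩
            ≈⟨ Σ.sum-remove {i = i} (λ k → facet k * s k c) ⟩
          facet i * s i c + sum (λ k → facet (punchIn i k) * removeAt s i k c)
            ≈⟨ +-cong (trans (*-congʳ (reflexive (insertAt-lookup (λ _ → 1#) i 0#))) (zeroˡ _))
                 (sum-cong (λ k → trans (*-congʳ {x = removeAt s i k c} (reflexive (insertAt-punchIn (λ _ → 1#) i 0# k))) (*-identityˡ _))) ⟩
          0# + sum (λ k → removeAt s i k c)   ≈⟨ +-identityˡ _ ⟩
          sum (λ k → removeAt s i k c)        ≈⟨ barycentre c ⟨
          sum (replicate 4 (g c))             ∎

      -- The linear part of the k-th barycentric coordinate, as a vector to be paired with a
      -- displacement.
      columns : Vector (Point 4) 5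
      columns k c = direction c k

      -- A displacement from g changes the k-th coordinate by its pairing with `columns k`, and
      -- eight times the coordinate of g is twice `facet k`.
      coordinates-near : ∀ p k → 1# + 8# * ⟨ (λ c → p c - g c) , columns k ⟩ ≈
                                 1# + 8# * coordinates p k - (facet k + facet k)
      coordinates-near p k = begin
        1# + 8# * ⟨ (λ c → p c - g c) , columns k ⟩
          ≈⟨ +-congˡ (*-congˡ (⟨⟩-minusˡ p g (columns k))) ⟩
        1# + 8# * (linComb p direction k - linComb g direction k)
          ≈⟨ solve 4 (λ o p g f → let i = con (1 , 0) ; four = (i :+ i) :+ (i :+ i) in
               i :+ (four :+ four) :* (p :- g) :=
               (i :+ (four :+ four) :* (o :+ p) :- (f :+ f)) :- ((four :* (o :+ g) :- f) :+ (four :* (o :+ g) :- f)))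
               refl (origin k) (linComb p direction k) (linComb g direction k) (facet k) ⟩
        (1# + 8# * coordinates p k - (facet k + facet k)) -
          ((4# * coordinates g k - facet k) + (4# * coordinates g k - facet k))
          ≈⟨ +-congˡ (-‿cong (+-cong (coordinates-barycentre k) (coordinates-barycentre k))) ⟩
        (1# + 8# * coordinates p k - (facet k + facet k)) - (0# + 0#)
          ≈⟨ solve 1 (λ x → x :- (con (0 , 0) :+ con (0 , 0)) := x) refl _ ⟩
        1# + 8# * coordinates p k - (facet k + facet k) ∎

    cappedSimplex : ForAllSufficientlyCloseTo g (λ p → p ∉ conv (range s) →
                      Attains 4 6 11 (vert (conv (conv (range s) ∪ ｛ p ｝))))
    cappedSimplex = let ε , 0<ε , near = smallPairings columns in
      ε , 0<ε , λ p close p∉ → cap p (near (λ c → p c - g c) close) p∉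
      where
      cap : ∀ p → (∀ k → 0# < 1# + 8# * ⟨ (λ c → p c - g c) , columns k ⟩) → p ∉ conv (range s) →
            Attains 4 6 11 (vert (conv (conv (range s) ∪ ｛ p ｝)))
      cap p near p∉ = CappedSimplex.attains-11 s i p β (sum-coordinates p) (linComb-coordinates p) βi<0 0<β
        -- The bounds β i > - 1/8 and β k > 1/8 add up to - β i < β k.
        (λ k → 0<y-x⇒x<y (*-cancel-pos 0<8 (<-respʳ-≈
          (solve 2 (λ b g → let o = con (1 , 0) ; four = (o :+ o) :+ (o :+ o) ; eight = four :+ four in
             (o :+ eight :* b) :+ (eight :* g :- o) := eight :* (g :- (:- b))) refl (β i) (β (punchIn i k)))
          (pos+nonneg below (inj₁ (above k))))))
        indep
        where
        β = coordinates p
        below : 0# < 1# + 8# * β i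
        below = <-respʳ-≈ (trans (coordinates-near p i)
          (trans (+-congˡ (-‿cong (+-cong facet-i facet-i))) (solve 1 (λ x → x :- (con (0 , 0) :+ con (0 , 0)) := x) refl _))) (near i)
          where
          facet-i = reflexive (insertAt-lookup (λ (_ : Fin 4) → 1#) i 0#)
        above : ∀ k → 0# < 8# * β (punchIn i k) - 1#
        above k = <-respʳ-≈ (trans (coordinates-near p (punchIn i k))
          (trans (+-congˡ (-‿cong (+-cong facet-k facet-k)))
            (solve 1 (λ x → con (1 , 0) :+ x :- (con (1 , 0) :+ con (1 , 0)) := x :- con (1 , 0)) refl _))) (near (punchIn i k))
          where
          facet-k = reflexive (insertAt-punchIn (λ _ → 1#) i 0# k)
        0<β : ∀ k → 0# < β (punchIn i k)
        0<β k = *-cancel-pos 0<8 (<-respʳ-≈ (solve 1 (λ x → x :- con (1 , 0) :+ con (1 , 0) := x) refl _)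
          (pos+nonneg (above k) (inj₁ 0<1)))
        -- This is where p lies outside the simplex: the facet coordinates are positive already, so
        -- β i ≥ 0 would make p a convex combination of s.
        βi<0 : β i < 0#
        βi<0 with β i <? 0#
        ... | yes p = p
        ... | no ¬p = contradiction
          (ConvexHull⊆conv-range (β , β≥0 , sum-coordinates p , ≋-sym (linComb-coordinates p))) p∉
          where
          β≥0 : ∀ k → 0# ≤ β k
          β≥0 k with i Fin.≟ k
          ... | yes ≡.refl = ≮⇒≥ ¬p
          ... | no i≢k     = ≡.subst (λ l → 0# ≤ β l) (punchIn-punchOut i≢k) (inj₁ (0<β (punchOut i≢k)))

theorem2p9 : (ℝ : RealNumbers) →
    Convex.MinSa ℝ 4 6 11
    × (∀ (B P : Convex.Subset ℝ 4) →
    Convex.IsParallelogram ℝ B → Convex.IsPyramid ℝ B 2 P →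
    Convex.Attains ℝ 4 6 11 (Convex.vert ℝ P))
    × (∀ (s : Vector (Convex.Point ℝ 4) 5) → Convex.AffinelyIndependent ℝ s →
    ∀ (i : Fin 5) (g : Convex.Point ℝ 4) → Convex.IsBarycentre ℝ (removeAt s i) g →
    Convex.ForAllSufficientlyCloseTo ℝ g (λ p →
    p ∉ Convex.conv ℝ (Convex.range ℝ s) →
    Convex.Attains ℝ 4 6 11
    (Convex.vert ℝ (Convex.conv ℝ
    (Convex.conv ℝ (Convex.range ℝ s) ∪ Convex.｛_｝ ℝ p)))))
theorem2p9 ℝ = (attained , lowerBound) , doublePyramid , cappedSimplex
  where open SixPoints ℝ
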